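{- Let $(W,S)$ be a finite Coxeter system and let $I\subsetneq S$. Then $W/W_I$ strongly percolates if and only if $|I|=|S|-1$.
   Context: A finite Coxeter system $(W,S)$: $W$ is a finite group with generating set $S=\{s_1,\dots,s_m\}$ and presentation $\langle s_1,\dots,s_m \mid (s_is_j)^{m_{ij}}=1\rangle$, $m_{ii}=1$, $m_{ij}=m_{ji}\ge2$ for $i\ne j$. $\ell(w)$ is the length of $w$ with respect to $S$; $T=\{usu^{ -1}:s\in S,u\in W\}$ is the set of reflections. For $I\subseteq S$, $W_I$ is the subgroup generated by $I$ and $w^I$ is the unique minimum-length element of the left coset $wW_I$. For $t\in T$: $L^I_t=\{wW_I:\ell((tw)^I)>\ell(w^I)\}$, $R^I_t=\{wW_I:\ell((tw)^I)<\ell(w^I)\}$, $F^I_t=\{wW_I:\ell((tw)^I)=\ell(w^I)\}$; the left-folding map is $t^+(wW_I)=twW_I$ if $wW_I\in R^I_t$ and $wW_I$ otherwise; the right-folding map is $t^-(wW_I)=twW_I$ if $wW_I\in L^I_t$ and $wW_I$ otherwise; for $X\subseteq W/W_I$, $X^\pm(t)=\{wW_I:t^\pm(wW_I)\in X\}$. A strong folding sequence is a sequence $J_0,J_1,\dots$ of subsets of $W/W_I$ such that for each $i$ there is $t_i\in T$ with $J_{i+1}=J_i^+(t_i)$ or $J_{i+1}=J_i^-(t_i)$, and $J_i$ meets both $L^I_{t_i}\cup F^I_{t_i}$ and $R^I_{t_i}\cup F^I_{t_i}$. A strong percolating sequence is a finite strong folding sequence starting from a pair $\{W_I,wW_I\}$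 and ending with $W/W_I$. $W/W_I$ strongly percolates if for every $w\in W\setminus W_I$ there is a strong percolating sequence starting from $\{W_I,wW_I\}$. -}

module Defs where

open import Level using (0ℓ)
open import Data.Nat using (ℕ; _≤_; _<_)
open import Data.Fin using (Fin)
open import Data.Fin.Subset using (Subset; _∈_)
open import Data.List using (List; []; _∷_; _++_; length; reverse; concat; replicate; [_])
open import Data.List.Relation.Unary.All using (All)
open import Data.List.Relation.Unary.Any using (Any)
open import Data.Product using (Σ; ∃; _×_)
open import Data.Sum using (_⊎_)
open import Relation.Nullary using (¬_)
open import Relation.Binary.PropositionalEquality using (_≡_; _≢_)

record CoxeterMatrix (n : ℕ) : Set where
  field
    m     : Fin n → Fin n → ℕ
    diag  : ∀ i → m i i ≡ 1
    symm  : ∀ i j → m i j ≡ m j i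
    off   : ∀ i j → i ≢ j → 2 ≤ m i j

module Coxeter {n : ℕ} (M : CoxeterMatrix n) where
  open CoxeterMatrix M

  -- Elements of W are represented by words in the generators S = Fin n.
  Word : Set
  Word = List (Fin n)

  relator : Fin n → Fin n → Word
  relator i j = concat (replicate (m i j) (i ∷ j ∷ []))

  -- equality in W = ⟨ S | (s_i s_j)^{m_ij} = 1 ⟩ : the congruence generated by the relators
  infix 4 _≈_
  data _≈_ : Word → Word → Set where
    ≈-refl  : ∀ {u} → u ≈ u
    ≈-sym   : ∀ {u v} → u ≈ v → v ≈ u
    ≈-trans : ∀ {u v w} → u ≈ v → v ≈ w → u ≈ w
    ≈-rel   : ∀ i j → relator i j ≈ []
    ≈-cong  : ∀ {a b c d} → a ≈ b → c ≈ d → a ++ c ≈ b ++ d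

  IsFinite : Set
  IsFinite = Σ (List Word) λ ws → ∀ w → Any (λ w′ → w ≈ w′) ws

  -- word length ℓ is realised on representatives; reflections t = u s u⁻¹
  -- (the inverse of a word is its reverse, the generators being involutions)
  reflection : Word → Fin n → Word
  reflection u s = u ++ [ s ] ++ reverse u

  module Parabolic (I : Subset n) where

    SameCoset : Word → Word → Set
    SameCoset u w = Σ Word λ v → All (_∈ I) v × (u ≈ w ++ v)

    CosetLen : Word → ℕ → Set
    CosetLen w k = (Σ Word λ u → SameCoset u w × length u ≡ k)
                 × (∀ u → SameCoset u w → k ≤ length u)

    L R F : Word → Word → Set
    L t w = ∃ λ a → ∃ λ b → CosetLen w a × CosetLen (t ++ w) b × a < b
    R t w = ∃ λ a → ∃ λ b → CosetLen w a × CosetLen (t ++ w) b × b < a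
    F t w = ∃ λ a → CosetLen w a × CosetLen (t ++ w) a

    -- subsets of W/W_I, represented as predicates on words (representatives)
    CSet : Set₁
    CSet = Word → Set

    -- X⁺(t) = { wW_I : t⁺(wW_I) ∈ X },  X⁻(t) = { wW_I : t⁻(wW_I) ∈ X }
    _⁺_ : CSet → Word → CSet
    (X ⁺ t) w = (R t w × X (t ++ w)) ⊎ (¬ R t w × X w)

    _⁻_ : CSet → Word → CSet
    (X ⁻ t) w = (L t w × X (t ++ w)) ⊎ (¬ L t w × X w)

    _≐_ : CSet → CSet → Set
    X ≐ Y = ∀ w → (X w → Y w) × (Y w → X w)

    StrongStep : CSet → CSet → Set
    StrongStep J J′ = Σ Word λ u → Σ (Fin n) λ s →
      let t = reflection u s in
      ((J′ ≐ (J ⁺ t)) ⊎ (J′ ≐ (J ⁻ t)))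
      × (∃ λ w → J w × (L t w ⊎ F t w))
      × (∃ λ w → J w × (R t w ⊎ F t w))

    data StrongPercolating (J : CSet) : Set₁ where
      done : (∀ w → J w) → StrongPercolating J
      step : (J′ : CSet) → StrongStep J J′ → StrongPercolating J′ → StrongPercolating J

    pair : Word → CSet
    pair w x = SameCoset x [] ⊎ SameCoset x w

    StronglyPercolates : Set₁
    StronglyPercolates = ∀ w → ¬ SameCoset w [] → StrongPercolating (pair w)

{-# OPTIONS --safe #-}
module Submission where

open import Defs
open import Data.Bool using (Bool; true; false; not; _xor_; if_then_else_)
open import Data.Bool.Properties using (¬-not; not-injective; xor-assoc; xor-same; xor-identityʳ)
open import Data.Empty using (⊥; ⊥-elim)
open import Data.Fin using (Fin; zero; suc; toℕ; fromℕ<; punchIn; punchOut)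
import Data.Fin.Properties as Fin
open import Data.Fin.Subset using (Subset; _∈_; _∉_; _⊂_; _⊆_; ⊤; ∣_∣; _∪_; ∁; ⁅_⁆)
import Data.Fin.Subset as Subset
open import Data.Fin.Subset.Properties
  using (∉⊥; ∈⊤; _∈?_; x∈⁅x⁆; x∈⁅y⁆⇒x≡y; x∈p∪q⁻; p⊆p∪q; q⊆p∪q; x∈∁p⇒x∉p;
         ∣⊤∣≡n; ∣⁅x⁆∣≡1; ∣∁p∣≡n∸∣p∣; p⊆q⇒∣p∣≤∣q∣; p⊂q⇒∣p∣<∣q∣)
open import Data.Integer using (ℤ; +_; 0ℤ; 1ℤ; -_) renaming (_+_ to _+ᶻ_; _-_ to _-ᶻ_; _*_ to _*ᶻ_)
import Data.Integer.Divisibility.Signed as ℤ∣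
import Data.Integer.Properties as ℤ
open import Data.Integer.Tactic.RingSolver using (solve-∀)
open import Data.List using (List; []; _∷_; _++_; [_]; length; lookup; reverse; concat; replicate; map; allFin)
open import Data.List.Membership.Propositional using () renaming (_∈_ to _∈ᴸ_)
open import Data.List.Membership.Propositional.Properties using (∈-allFin)
open import Data.List.Properties using (++-assoc; ++-identityʳ; unfold-reverse)
open import Data.List.Relation.Unary.All as All using (All; []; _∷_)
import Data.List.Relation.Unary.All.Properties as All
open import Data.List.Relation.Unary.Any using (Any; here; there; index)
open import Data.List.Relation.Unary.Any.Properties using (lookup-index)
open import Data.Nat using (ℕ; zero; suc; _+_; _*_; _∸_; _≤_; _<_; z≤n; s≤s; NonZero)
open import Data.Nat.Divisibility using (∣⇒≤)
open import Data.Nat.ListAction using (sum)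
import Data.Nat.Properties as ℕ
open import Data.Product using (∃; ∃-syntax; _×_; _,_; proj₁; proj₂)
open import Data.Sum using (_⊎_; inj₁; inj₂)
open import Data.Vec using (Vec; []; _∷_; updateAt) renaming (replicate to replicateᵛ)
open import Data.Vec.Properties using (updateAt-updateAt-local; updateAt-commutes; updateAt-id-local)
open import Function using (_∘_)
open import Function.Bundles using (_⇔_; mk⇔)
open import Relation.Binary.Bundles using (Setoid)
open import Relation.Binary.PropositionalEquality
  using (_≡_; _≢_; _≗_; refl; sym; trans; cong; cong₂; subst; module ≡-Reasoning)
import Relation.Binary.Reasoning.Setoid as SetoidReasoning
open import Relation.Nullary using (¬_; Dec; yes; no; does; contradiction)
open import Relation.Nullary.Decidable using (does-⇔; map′; dec-true; dec-false; decidable-stable)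
open import Relation.Unary using (Decidable)

-- If I = S ∖ {s}, simple folds suffice: the left and right foldings along s_i ∈ I fix W_I, so
-- right foldings bring wW_I down to a coset whose minimal representative starts with s, and the
-- left folding along s then yields a set containing W_I and sW_I. Left foldings along all generators,
-- repeated cyclically, now fill W/W_I length by length.
--
-- If s ≠ s′ both lie outside I, put K = I ∪ {s}. A reflection t moving a coset gW_K has all of
-- gW_K/W_I strictly on one side, because the parity of the occurrences of t among the inversions
-- of w is constant on gW_K; so a strong folding sequence starting in W_K/W_I never leaves a single
-- coset of W_K. It cannot reach W/W_I, since s′ ∉ W_K. This last fact, that no generator lies in
-- the parabolic subgroup of the others, comes from a reflection representation with off-diagonal
-- entries ζ + ζ⁻¹, where the ζ are commuting shifts on integer-valued functions on a lattice,
-- restricted to functions on which they act as suitable roots of unity.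
--
-- Finiteness of W makes equality of cosets decidable, which the folds and the parities require.

-- Words modulo the Coxeter relations

module Words {n : ℕ} (M : CoxeterMatrix n) where
  open CoxeterMatrix M
  open Coxeter M public

  ≈-setoid : Setoid _ _
  ≈-setoid = record
    { Carrier = Word ; _≈_ = _≈_
    ; isEquivalence = record { refl = ≈-refl ; sym = ≈-sym ; trans = ≈-trans } }

  module ≈-Reasoning = SetoidReasoning ≈-setoid

  ≈-reflexive : ∀ {u v} → u ≡ v → u ≈ v
  ≈-reflexive refl = ≈-refl

  ++-congˡ : ∀ u {v w} → v ≈ w → u ++ v ≈ u ++ w
  ++-congˡ u = ≈-cong (≈-refl {u})

  ++-congʳ : ∀ {u v} w → u ≈ v → u ++ w ≈ v ++ w
  ++-congʳ w e = ≈-cong e (≈-refl {w})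

  ∷-cong : ∀ i {v w} → v ≈ w → i ∷ v ≈ i ∷ w
  ∷-cong i = ++-congˡ [ i ]

  involutive : ∀ i → i ∷ i ∷ [] ≈ []
  involutive i = subst (λ k → concat (replicate k (i ∷ i ∷ [])) ≈ []) (diag i) (≈-rel i i)

  cancel : ∀ i w → i ∷ i ∷ w ≈ w
  cancel i w = ++-congʳ w (involutive i)

  reverse-inverseʳ : ∀ w → w ++ reverse w ≈ []
  reverse-inverseʳ []      = ≈-refl
  reverse-inverseʳ (i ∷ w) = begin
    i ∷ w ++ reverse (i ∷ w)       ≡⟨ cong (λ v → i ∷ w ++ v) (unfold-reverse i w) ⟩
    i ∷ w ++ (reverse w ++ [ i ])  ≡⟨ cong (i ∷_) (++-assoc w (reverse w) [ i ]) ⟨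
    i ∷ (w ++ reverse w) ++ [ i ]  ≈⟨ ∷-cong i (++-congʳ [ i ] (reverse-inverseʳ w)) ⟩
    i ∷ i ∷ []                     ≈⟨ involutive i ⟩
    []                             ∎
    where open ≈-Reasoning

  reverse-inverseˡ : ∀ w → reverse w ++ w ≈ []
  reverse-inverseˡ []      = ≈-refl
  reverse-inverseˡ (i ∷ w) = begin
    reverse (i ∷ w) ++ i ∷ w       ≡⟨ cong (_++ i ∷ w) (unfold-reverse i w) ⟩
    (reverse w ++ [ i ]) ++ i ∷ w  ≡⟨ ++-assoc (reverse w) [ i ] (i ∷ w) ⟩
    reverse w ++ i ∷ i ∷ w         ≈⟨ ++-congˡ (reverse w) (cancel i w) ⟩
    reverse w ++ w                 ≈⟨ reverse-inverseˡ w ⟩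
    []                             ∎
    where open ≈-Reasoning

  ++-cancelˡ : ∀ u {v w} → u ++ v ≈ u ++ w → v ≈ w
  ++-cancelˡ u {v} {w} e = begin
    v                       ≈⟨ ++-congʳ v (reverse-inverseˡ u) ⟨
    (reverse u ++ u) ++ v   ≡⟨ ++-assoc (reverse u) u v ⟩
    reverse u ++ u ++ v     ≈⟨ ++-congˡ (reverse u) e ⟩
    reverse u ++ u ++ w     ≡⟨ ++-assoc (reverse u) u w ⟨
    (reverse u ++ u) ++ w   ≈⟨ ++-congʳ w (reverse-inverseˡ u) ⟩
    w                       ∎
    where open ≈-Reasoning

  swap-letter : ∀ i {v w} → i ∷ v ≈ w → v ≈ i ∷ w
  swap-letter i {v} e = ≈-trans (≈-sym (cancel i v)) (∷-cong i e)

  reflection-involutive : ∀ u s w → reflection u s ++ reflection u s ++ w ≈ w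
  reflection-involutive u s w = begin
    (u ++ s ∷ reverse u) ++ (u ++ s ∷ reverse u) ++ w  ≡⟨ assoc₁ _ ⟩
    u ++ s ∷ reverse u ++ (u ++ s ∷ reverse u) ++ w    ≡⟨ cong (λ v → u ++ s ∷ reverse u ++ v) (assoc₁ w) ⟩
    u ++ s ∷ reverse u ++ u ++ s ∷ reverse u ++ w      ≡⟨ cong (λ v → u ++ s ∷ v) (++-assoc (reverse u) u _) ⟨
    u ++ s ∷ (reverse u ++ u) ++ s ∷ reverse u ++ w    ≈⟨ ++-congˡ u (∷-cong s (++-congʳ _ (reverse-inverseˡ u))) ⟩
    u ++ s ∷ s ∷ reverse u ++ w                        ≈⟨ ++-congˡ u (cancel s _) ⟩
    u ++ reverse u ++ w                                ≡⟨ ++-assoc u (reverse u) w ⟨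
    (u ++ reverse u) ++ w                              ≈⟨ ++-congʳ w (reverse-inverseʳ u) ⟩
    w                                                  ∎
    where
    open ≈-Reasoning
    assoc₁ : ∀ w → (u ++ s ∷ reverse u) ++ w ≡ u ++ s ∷ reverse u ++ w
    assoc₁ w = ++-assoc u (s ∷ reverse u) w

-- Cosets of `W_I` and deciding their equality

module Cosets {n : ℕ} (M : CoxeterMatrix n) (I : Subset n) where
  open Words M
  open Parabolic I public

  All-reverse : ∀ {v} → All (_∈ I) v → All (_∈ I) (reverse v)
  All-reverse {[]}    []       = []
  All-reverse {i ∷ v} (p ∷ ps) =
    subst (All (_∈ I)) (sym (unfold-reverse i v)) (All.++⁺ (All-reverse ps) (p ∷ []))

  ≈⇒~ : ∀ {u w} → u ≈ w → SameCoset u w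
  ≈⇒~ {u} {w} e = [] , [] , ≈-trans e (≈-reflexive (sym (++-identityʳ w)))

  ~-refl : ∀ {u} → SameCoset u u
  ~-refl = ≈⇒~ ≈-refl

  ~-sym : ∀ {u w} → SameCoset u w → SameCoset w u
  ~-sym {u} {w} (v , vI , e) = reverse v , All-reverse vI , (begin
    w                       ≡⟨ ++-identityʳ w ⟨
    w ++ []                 ≈⟨ ++-congˡ w (reverse-inverseʳ v) ⟨
    w ++ v ++ reverse v     ≡⟨ ++-assoc w v (reverse v) ⟨
    (w ++ v) ++ reverse v   ≈⟨ ++-congʳ (reverse v) e ⟨
    u ++ reverse v          ∎)
    where open ≈-Reasoning

  ~-trans : ∀ {u w x} → SameCoset u w → SameCoset w x → SameCoset u x
  ~-trans {u} {w} {x} (v , vI , e) (v′ , vI′ , e′) = v′ ++ v , All.++⁺ vI′ vI , (begin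
    u               ≈⟨ e ⟩
    w ++ v          ≈⟨ ++-congʳ v e′ ⟩
    (x ++ v′) ++ v  ≡⟨ ++-assoc x v′ v ⟩
    x ++ v′ ++ v    ∎)
    where open ≈-Reasoning

  ~-++ : ∀ t {u w} → SameCoset u w → SameCoset (t ++ u) (t ++ w)
  ~-++ t {u} {w} (v , vI , e) =
    v , vI , ≈-trans (++-congˡ t e) (≈-reflexive (sym (++-assoc t w v)))

  ~-absorb : ∀ {i} → i ∈ I → SameCoset [ i ] []
  ~-absorb {i} i∈I = [ i ] , i∈I ∷ [] , ≈-refl

  -- A cover of W/W_I by the words `rep p` yields a multiplication table `act` on the indices.
  -- Either the table satisfies all the relations, and then it separates cosets, or two distinct
  -- indices represent the same coset and the cover can be shrunk.
  covered⇒dec : ∀ N (rep : Fin N → Word) → (∀ w → ∃[ p ] SameCoset w (rep p)) →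
                ∀ u w → Dec (SameCoset u w)
  covered⇒dec zero    rep cover = contradiction (proj₁ (cover [])) λ ()
  covered⇒dec (suc N) rep cover =
    decide (Fin.all? λ i → Fin.all? λ j → Fin.all? λ p → act (relator i j) p Fin.≟ p)
           (Fin.all? λ i → stabilises? i)
    where
    act : Word → Fin (suc N) → Fin (suc N)
    act []      p = p
    act (i ∷ u) p = proj₁ (cover (i ∷ rep (act u p)))

    base : Fin (suc N)
    base = proj₁ (cover [])

    act-++ : ∀ u v p → act (u ++ v) p ≡ act u (act v p)
    act-++ []      v p = refl
    act-++ (i ∷ u) v p = cong (λ q → proj₁ (cover (i ∷ rep q))) (act-++ u v p)

    act-rep : ∀ u p → SameCoset (u ++ rep p) (rep (act u p))
    act-rep []      p = ~-refl
    act-rep (i ∷ u) p = ~-trans (~-++ [ i ] (act-rep u p)) (proj₂ (cover (i ∷ rep (act u p))))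

    -- The index reached from `base` determines the coset whether or not the table satisfies the
    -- relations; only the converse depends on them.
    act-base : ∀ u → SameCoset u (rep (act u base))
    act-base u = ~-trans (≈⇒~ (≈-reflexive (sym (++-identityʳ u))))
                         (~-trans (~-++ u (proj₂ (cover []))) (act-rep u base))

    Stabilises : Fin n → Set
    Stabilises i = i ∈ I → act [ i ] base ≡ base

    stabilises? : ∀ i → Dec (Stabilises i)
    stabilises? i with i ∈? I | act [ i ] base Fin.≟ base
    ... | no  i∉I | _      = yes λ i∈I → contradiction i∈I i∉I
    ... | yes _   | yes e  = yes λ _ → e
    ... | yes i∈I | no ne  = no λ f → ne (f i∈I)

    shrink : ∀ {p q} → p ≢ q → SameCoset (rep p) (rep q) → ∀ u w → Dec (SameCoset u w)
    shrink {p} {q} p≢q p~q = covered⇒dec N (rep ∘ punchIn p) cover′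
      where
      cover′ : ∀ w → ∃[ r ] SameCoset w (rep (punchIn p r))
      cover′ w with cover w
      ... | r , w~r with p Fin.≟ r
      ...   | yes refl = punchOut p≢q ,
        subst (λ x → SameCoset w (rep x)) (sym (Fin.punchIn-punchOut p≢q)) (~-trans w~r p~q)
      ...   | no  p≢r  = punchOut p≢r ,
        subst (λ x → SameCoset w (rep x)) (sym (Fin.punchIn-punchOut p≢r)) w~r

    decide : Dec (∀ i j p → act (relator i j) p ≡ p) → Dec (∀ i → Stabilises i) →
             ∀ u w → Dec (SameCoset u w)
    decide (no ¬rel) _ with Fin.¬∀⟶∃¬ _ _ (λ i → Fin.all? λ j → Fin.all? λ p → act (relator i j) p Fin.≟ p) ¬rel
    ... | i , ¬rel-i with Fin.¬∀⟶∃¬ _ _ (λ j → Fin.all? λ p → act (relator i j) p Fin.≟ p) ¬rel-i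
    ... | j , ¬rel-ij with Fin.¬∀⟶∃¬ _ _ (λ p → act (relator i j) p Fin.≟ p) ¬rel-ij
    -- A relator is trivial in W, so the distinct indices `p` and `act (relator i j) p` name one
    -- coset.
    ... | p , moved = shrink moved
      (~-sym (~-trans (≈⇒~ (≈-sym (++-congʳ (rep p) (≈-rel i j)))) (act-rep (relator i j) p)))
    decide (yes _) (no ¬stab) with Fin.¬∀⟶∃¬ _ _ stabilises? ¬stab
    ... | i , ¬stab-i = shrink {act [ i ] base} {base} (λ e → ¬stab-i λ _ → e)
      (~-trans (~-sym (act-base [ i ])) (~-trans (~-absorb i∈I) (proj₂ (cover []))))
      where
      i∈I : i ∈ I
      i∈I with i ∈? I
      ... | yes p = p
      ... | no ¬p = contradiction (λ p → contradiction p ¬p) ¬stab-i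
    decide (yes rel) (yes stab) u w =
      map′ (λ e → ~-trans (act-base u) (subst (λ q → SameCoset (rep q) w) (sym e) (~-sym (act-base w))))
           sound (act u base Fin.≟ act w base)
      where
      act-≈ : ∀ {u v} → u ≈ v → ∀ p → act u p ≡ act v p
      act-≈ ≈-refl        p = refl
      act-≈ (≈-sym e)     p = sym (act-≈ e p)
      act-≈ (≈-trans e f) p = trans (act-≈ e p) (act-≈ f p)
      act-≈ (≈-rel i j)   p = rel i j p
      act-≈ (≈-cong {a} {b} {c} {d} e f) p = begin
        act (a ++ c) p     ≡⟨ act-++ a c p ⟩
        act a (act c p)    ≡⟨ cong (act a) (act-≈ f p) ⟩
        act a (act d p)    ≡⟨ act-≈ e (act d p) ⟩
        act b (act d p)    ≡⟨ act-++ b d p ⟨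
        act (b ++ d) p     ∎
        where open ≡-Reasoning

      act-I : ∀ {v} → All (_∈ I) v → act v base ≡ base
      act-I []           = refl
      act-I (i∈I ∷ v∈I) = trans (cong (act [ _ ]) (act-I v∈I)) (stab _ i∈I)

      sound : SameCoset u w → act u base ≡ act w base
      sound (v , vI , e) = trans (act-≈ e base) (trans (act-++ w v base) (cong (act w) (act-I vI)))

  module Finite (fin : IsFinite) where

    _~?_ : ∀ u w → Dec (SameCoset u w)
    _~?_ = covered⇒dec _ (lookup (proj₁ fin))
             λ w → index (proj₂ fin w) , ≈⇒~ (lookup-index (proj₂ fin w))

-- Parity of inversions and the exchange property

xorSum : ℕ → (ℕ → Bool) → Bool
xorSum zero    f = false
xorSum (suc k) f = f 0 xor xorSum k (f ∘ suc)

xorSum-cong : ∀ k {f g : ℕ → Bool} → (∀ l → f l ≡ g l) → xorSum k f ≡ xorSum k g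
xorSum-cong zero    e = refl
xorSum-cong (suc k) e = cong₂ _xor_ (e 0) (xorSum-cong k (e ∘ suc))

xorSum-+ : ∀ k l f → xorSum (k + l) f ≡ xorSum k f xor xorSum l (f ∘ (λ j → k + j))
xorSum-+ zero    l f = refl
xorSum-+ (suc k) l f =
  trans (cong (f 0 xor_) (xorSum-+ k l (f ∘ suc))) (sym (xor-assoc (f 0) _ _))

-- The range consists of two full periods, whose contributions cancel modulo 2.
xorSum-periodic : ∀ k f → (∀ l → f (k + l) ≡ f l) → xorSum (k * 2) f ≡ false
xorSum-periodic k f per = begin
  xorSum (k * 2) f                      ≡⟨ cong (λ j → xorSum j f) k*2≡k+k ⟩
  xorSum (k + k) f                      ≡⟨ xorSum-+ k k f ⟩
  xorSum k f xor xorSum k (f ∘ (λ j → k + j))  ≡⟨ cong (xorSum k f xor_) (xorSum-cong k per) ⟩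
  xorSum k f xor xorSum k f             ≡⟨ xor-same (xorSum k f) ⟩
  false                                 ∎
  where
  open ≡-Reasoning
  k*2≡k+k : k * 2 ≡ k + k
  k*2≡k+k = trans (ℕ.*-comm k 2) (cong (λ j → k + j) (ℕ.+-identityʳ k))

module Inversions {n : ℕ} (M : CoxeterMatrix n)
                  (_≈?_ : ∀ u v → Dec (Coxeter._≈_ M u v)) where
  open CoxeterMatrix M
  open Words M

  -- For u = i₁⋯iₖ, `inv u t` is the parity of the number of positions j at which
  -- t = i₁⋯i_{j-1} i_j i_{j-1}⋯i₁.
  inv : Word → Word → Bool
  inv []      t = false
  inv (i ∷ u) t = does (t ≈? [ i ]) xor inv u (i ∷ t ++ [ i ])

  -- A word for u⁻¹tu, built letter by letter in step with `inv`, so that `inv-++` is the cocycle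
  -- identity of the inversion parity.
  conj : Word → Word → Word
  conj []      t = t
  conj (i ∷ u) t = conj u (i ∷ t ++ [ i ])

  conj-spec : ∀ u t → u ++ conj u t ≈ t ++ u
  conj-spec []      t = ≈-reflexive (sym (++-identityʳ t))
  conj-spec (i ∷ u) t = begin
    i ∷ u ++ conj u (i ∷ t ++ [ i ])  ≈⟨ ∷-cong i (conj-spec u (i ∷ t ++ [ i ])) ⟩
    i ∷ i ∷ (t ++ [ i ]) ++ u         ≈⟨ cancel i _ ⟩
    (t ++ [ i ]) ++ u                 ≡⟨ ++-assoc t [ i ] u ⟩
    t ++ i ∷ u                        ∎
    where open ≈-Reasoning

  inv-congʳ : ∀ u {t t′} → t ≈ t′ → inv u t ≡ inv u t′
  inv-congʳ []      e = refl
  inv-congʳ (i ∷ u) {t} {t′} e = cong₂ _xor_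
    (does-⇔ (mk⇔ (≈-trans (≈-sym e)) (≈-trans e)) (t ≈? [ i ]) (t′ ≈? [ i ]))
    (inv-congʳ u (∷-cong i (++-congʳ [ i ] e)))

  inv-++ : ∀ u v t → inv (u ++ v) t ≡ inv u t xor inv v (conj u t)
  inv-++ []      v t = refl
  inv-++ (i ∷ u) v t = trans (cong (does (t ≈? [ i ]) xor_) (inv-++ u v (i ∷ t ++ [ i ])))
                             (sym (xor-assoc (does (t ≈? [ i ])) _ _))

  conj-cong : ∀ {u v} t → u ≈ v → conj u t ≈ conj v t
  conj-cong {u} {v} t e = ++-cancelˡ u (begin
    u ++ conj u t  ≈⟨ conj-spec u t ⟩
    t ++ u         ≈⟨ ++-congˡ t e ⟩
    t ++ v         ≈⟨ conj-spec v t ⟨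
    v ++ conj v t  ≈⟨ ++-congʳ (conj v t) e ⟨
    u ++ conj v t  ∎)
    where open ≈-Reasoning

  module _ (i j : Fin n) where

    power : ℕ → Word
    power k = concat (replicate k (i ∷ j ∷ []))

    power-+ : ∀ k l → power (k + l) ≡ power k ++ power l
    power-+ zero    l = refl
    power-+ (suc k) l = cong (λ w → i ∷ j ∷ w) (power-+ k l)

    power-i-ji : ∀ k → (power k ++ [ i ]) ++ j ∷ i ∷ [] ≡ power (suc k) ++ [ i ]
    power-i-ji zero    = refl
    power-i-ji (suc k) = cong (λ w → i ∷ j ∷ w) (power-i-ji k)

    -- Since i(ji) = (ij)i, conjugation by s_i s_j shifts the exponent in (s_i s_j)^k s_i by two.
    conj-power : ∀ t k → j ∷ (i ∷ t ++ [ i ]) ++ [ j ] ≈ power k ++ [ i ] ⇔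
                         t ≈ power (2 + k) ++ [ i ]
    conj-power t k = mk⇔ to from
      where
      open ≈-Reasoning
      expand : (j ∷ (i ∷ t ++ [ i ]) ++ [ j ]) ++ j ∷ i ∷ [] ≈ j ∷ i ∷ t
      expand = begin
        j ∷ i ∷ ((t ++ [ i ]) ++ [ j ]) ++ j ∷ i ∷ []
          ≡⟨ cong (λ w → j ∷ i ∷ w) (trans (++-assoc (t ++ [ i ]) [ j ] _) (++-assoc t [ i ] _)) ⟩
        j ∷ i ∷ t ++ i ∷ j ∷ j ∷ i ∷ []
          ≈⟨ ++-congˡ (j ∷ i ∷ t) (≈-trans (∷-cong i (cancel j [ i ])) (involutive i)) ⟩
        j ∷ i ∷ t ++ []
          ≡⟨ cong (λ w → j ∷ i ∷ w) (++-identityʳ t) ⟩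
        j ∷ i ∷ t ∎
      to : _ → _
      to e = swap-letter i (swap-letter j (begin
        j ∷ i ∷ t                                      ≈⟨ expand ⟨
        (j ∷ (i ∷ t ++ [ i ]) ++ [ j ]) ++ j ∷ i ∷ []  ≈⟨ ++-congʳ _ e ⟩
        (power k ++ [ i ]) ++ j ∷ i ∷ []               ≡⟨ power-i-ji k ⟩
        power (suc k) ++ [ i ]                         ∎))
      from : _ → _
      from e = begin
        j ∷ (i ∷ t ++ [ i ]) ++ [ j ]
          ≡⟨ cong (λ w → j ∷ i ∷ w) (++-assoc t [ i ] [ j ]) ⟩
        j ∷ i ∷ t ++ i ∷ j ∷ []
          ≈⟨ ∷-cong j (∷-cong i (++-congʳ _ e)) ⟩
        j ∷ i ∷ (i ∷ j ∷ power (suc k) ++ [ i ]) ++ i ∷ j ∷ []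
          ≈⟨ ∷-cong j (cancel i _) ⟩
        j ∷ j ∷ (power (suc k) ++ [ i ]) ++ i ∷ j ∷ []
          ≈⟨ cancel j _ ⟩
        (power (suc k) ++ [ i ]) ++ i ∷ j ∷ []
          ≡⟨ cong (_++ i ∷ j ∷ []) (power-i-ji k) ⟨
        ((power k ++ [ i ]) ++ j ∷ i ∷ []) ++ i ∷ j ∷ []
          ≡⟨ ++-assoc (power k ++ [ i ]) _ _ ⟩
        (power k ++ [ i ]) ++ j ∷ i ∷ i ∷ j ∷ []
          ≈⟨ ++-congˡ (power k ++ [ i ]) (≈-trans (∷-cong j (cancel i [ j ])) (involutive j)) ⟩
        (power k ++ [ i ]) ++ []
          ≡⟨ ++-identityʳ _ ⟩
        power k ++ [ i ] ∎

    conj-i : ∀ t → i ∷ t ++ [ i ] ≈ [ j ] ⇔ t ≈ i ∷ j ∷ i ∷ []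
    conj-i t = mk⇔
      (λ e → ≈-trans (≈-sym shift) (∷-cong i (++-congʳ [ i ] e)))
      (λ e → ≈-trans (∷-cong i (++-congʳ [ i ] e))
                     (≈-trans (cancel i _) (∷-cong j (involutive i))))
      where
      open ≈-Reasoning
      shift : i ∷ (i ∷ t ++ [ i ]) ++ [ i ] ≈ t
      shift = begin
        i ∷ i ∷ (t ++ [ i ]) ++ [ i ]  ≈⟨ cancel i _ ⟩
        (t ++ [ i ]) ++ [ i ]          ≡⟨ ++-assoc t [ i ] [ i ] ⟩
        t ++ i ∷ i ∷ []                ≈⟨ ++-congˡ t (involutive i) ⟩
        t ++ []                        ≡⟨ ++-identityʳ t ⟩
        t                              ∎

    -- The first two letters account for the dihedral reflections with l = 0 and l = 1; passing to
    -- the rest of the word conjugates by s_i s_j and so shifts l by two.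
    inv-power : ∀ k t → inv (power k) t ≡ xorSum (k * 2) (λ l → does (t ≈? (power l ++ [ i ])))
    inv-power zero    t = refl
    inv-power (suc k) t = cong (does (t ≈? [ i ]) xor_) (cong₂ _xor_
      (does-⇔ (conj-i t) ((i ∷ t ++ [ i ]) ≈? [ j ]) (t ≈? (i ∷ j ∷ i ∷ [])))
      (trans (inv-power k _) (xorSum-cong (k * 2) λ l →
        does-⇔ (conj-power t l) (_ ≈? (power l ++ [ i ])) (t ≈? (power (2 + l) ++ [ i ])))))

    -- The reflections (s_i s_j)^l s_i recur with period m_ij in l, and the relator runs through two
    -- periods.
    inv-relator : ∀ t → inv (relator i j) t ≡ false
    inv-relator t = trans (inv-power (m i j) t) (xorSum-periodic (m i j) _ λ l →
      does-⇔ (mk⇔ (λ e → ≈-trans e (period l)) (λ e → ≈-trans e (≈-sym (period l))))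
             (t ≈? (power (m i j + l) ++ [ i ])) (t ≈? (power l ++ [ i ])))
      where
      period : ∀ l → power (m i j + l) ++ [ i ] ≈ power l ++ [ i ]
      period l = ++-congʳ [ i ]
        (≈-trans (≈-reflexive (power-+ (m i j) l)) (++-congʳ (power l) (≈-rel i j)))

  -- By the cocycle identity `inv-++` it is enough that relators contribute nothing; the parity is
  -- thus a function on W.
  inv-congˡ : ∀ {u v} → u ≈ v → ∀ t → inv u t ≡ inv v t
  inv-congˡ ≈-refl        t = refl
  inv-congˡ (≈-sym e)     t = sym (inv-congˡ e t)
  inv-congˡ (≈-trans e f) t = trans (inv-congˡ e t) (inv-congˡ f t)
  inv-congˡ (≈-rel i j)   t = inv-relator i j t
  inv-congˡ (≈-cong {a} {b} {c} {d} e f) t = begin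
    inv (a ++ c) t                   ≡⟨ inv-++ a c t ⟩
    inv a t xor inv c (conj a t)     ≡⟨ cong₂ _xor_ (inv-congˡ e t)
                                          (trans (inv-congˡ f (conj a t)) (inv-congʳ d (conj-cong t e))) ⟩
    inv b t xor inv d (conj b t)     ≡⟨ inv-++ b d t ⟨
    inv (b ++ d) t                   ∎
    where open ≡-Reasoning

  -- An odd number of occurrences is not zero, so t arises at some position of u, and multiplying by
  -- t deletes the letter there. Deletion introduces no new letters, hence the clause about K.
  exchange : ∀ u t → inv u t ≡ true →
             ∃[ u′ ] length u′ < length u × t ++ u ≈ u′ × (∀ K → All (_∈ K) u → All (_∈ K) u′)
  exchange (i ∷ u) t e with t ≈? [ i ]
  ... | yes t≈i = u , ℕ.≤-refl , ≈-trans (++-congʳ (i ∷ u) t≈i) (cancel i u) , λ { K (_ ∷ ps) → ps }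
  ... | no  _   with exchange u (i ∷ t ++ [ i ]) e
  ...   | u′ , u′<u , e′ , sub =
    i ∷ u′ , s≤s u′<u , ≈-trans (swap-letter i shift) (∷-cong i e′) , λ { K (p ∷ ps) → p ∷ sub K ps }
    where
    shift : i ∷ t ++ i ∷ u ≈ (i ∷ t ++ [ i ]) ++ u
    shift = ≈-reflexive (cong (i ∷_) (sym (++-assoc t [ i ] u)))

  -- The middle letter counts once. The contributions of u and of its reverse cancel, because
  -- together they are the parity for u u⁻¹ = 1.
  inv-reflection : ∀ u s → inv (reflection u s) (reflection u s) ≡ true
  inv-reflection u s = begin
    inv (u ++ s ∷ reverse u) t                                      ≡⟨ inv-++ u (s ∷ reverse u) t ⟩
    inv u t xor inv (s ∷ reverse u) (conj u t)
      ≡⟨ cong (inv u t xor_) (inv-congʳ (s ∷ reverse u) conj-t) ⟩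
    inv u t xor (does ([ s ] ≈? [ s ]) xor inv (reverse u) (s ∷ s ∷ s ∷ []))
      ≡⟨ cong (λ b → inv u t xor (b xor inv (reverse u) (s ∷ s ∷ s ∷ []))) (dec-true ([ s ] ≈? [ s ]) ≈-refl) ⟩
    inv u t xor not (inv (reverse u) (s ∷ s ∷ s ∷ []))
      ≡⟨ cong (λ b → inv u t xor not b) (inv-congʳ (reverse u) (≈-trans (cancel s [ s ]) (≈-sym conj-t))) ⟩
    inv u t xor not (inv (reverse u) (conj u t))                    ≡⟨ xor-not (inv u t) _ cancelled ⟩
    true                                                            ∎
    where
    open ≡-Reasoning
    t = reflection u s
    conj-t : conj u t ≈ [ s ]
    conj-t = ++-cancelˡ u (≈-trans (conj-spec u t) (≈-trans
      (≈-reflexive (++-assoc u (s ∷ reverse u) u))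
      (++-congˡ u (∷-cong s (reverse-inverseˡ u)))))
    cancelled : inv u t xor inv (reverse u) (conj u t) ≡ false
    cancelled = trans (sym (inv-++ u (reverse u) t)) (inv-congˡ (reverse-inverseʳ u) t)
    xor-not : ∀ a b → a xor b ≡ false → a xor not b ≡ true
    xor-not false false e = refl
    xor-not true  true  e = refl

  inv-reflected : ∀ u s w → inv (reflection u s ++ w) (reflection u s) ≡ not (inv w (reflection u s))
  inv-reflected u s w = begin
    inv (t ++ w) t                  ≡⟨ inv-++ t w t ⟩
    inv t t xor inv w (conj t t)    ≡⟨ cong₂ _xor_ (inv-reflection u s) (inv-congʳ w (++-cancelˡ t (conj-spec t t))) ⟩
    not (inv w t)                   ∎
    where
    open ≡-Reasoning
    t = reflection u s

-- Confinement of strong folding sequences to one coset of `W_K`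

module Confinement {n : ℕ} (M : CoxeterMatrix n) (fin : Coxeter.IsFinite M)
                   (I K : Subset n) (I⊆K : I ⊆ K) where
  open Words M
  module I = Cosets M I
  module K = Cosets M K

  -- The cosets of the parabolic subgroup of the empty set are the elements of W.
  _≈?_ : ∀ u v → Dec (u ≈ v)
  u ≈? v = map′ strip ⊥-cosets.≈⇒~ (⊥-cosets.Finite._~?_ fin u v)
    where
    module ⊥-cosets = Cosets M Subset.⊥
    strip : ⊥-cosets.SameCoset u v → u ≈ v
    strip ([]    , _      , e) = ≈-trans e (≈-reflexive (++-identityʳ v))
    strip (_ ∷ _ , i∈⊥ ∷ _ , _) = contradiction i∈⊥ ∉⊥

  open Inversions M _≈?_

  I⇒K : ∀ {u w} → I.SameCoset u w → K.SameCoset u w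
  I⇒K (v , vI , e) = v , All.map I⊆K vI , e

  len-unique : ∀ {w a b} → I.CosetLen w a → I.CosetLen w b → a ≡ b
  len-unique ((u , u~w , refl) , min) ((u′ , u′~w , refl) , min′) =
    ℕ.≤-antisym (min u′ u′~w) (min′ u u~w)

  module _ (r : Word) (s : Fin n) (g : Word) where
    private t = reflection r s

    -- Exchange rewrites (g⁻¹tg)v as a word over K, so g⁻¹tg lies in W_K.
    inverts⇒stable : ∀ {v} → All (_∈ K) v → inv v (conj g t) ≡ true → K.SameCoset (t ++ g) g
    inverts⇒stable {v} vK inverted with exchange v (conj g t) inverted
    ... | v′ , _ , e , sub = K.~-trans (K.~-sym (v , vK , ≈-refl)) (v′ , sub K vK , (begin
      (t ++ g) ++ v          ≈⟨ ++-congʳ v (conj-spec g t) ⟨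
      (g ++ conj g t) ++ v   ≡⟨ ++-assoc g (conj g t) v ⟩
      g ++ conj g t ++ v     ≈⟨ ++-congˡ g e ⟩
      g ++ v′                ∎))
      where open ≈-Reasoning

    inv-const : ¬ K.SameCoset (t ++ g) g → ∀ {w} → K.SameCoset w g → inv w t ≡ inv g t
    inv-const moved {w} (v , vK , e) = begin
      inv w t                        ≡⟨ inv-congˡ e t ⟩
      inv (g ++ v) t                 ≡⟨ inv-++ g v t ⟩
      inv g t xor inv v (conj g t)   ≡⟨ cong (inv g t xor_) no-inversion ⟩
      inv g t xor false              ≡⟨ xor-identityʳ (inv g t) ⟩
      inv g t                        ∎
      where
      open ≡-Reasoning
      no-inversion : inv v (conj g t) ≡ false
      no-inversion = ¬-not λ inverted → moved (inverts⇒stable vK inverted)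

    -- A shortest representative x of wW_I still lies in gW_K, so t is an inversion of x and
    -- exchange yields a shorter representative of twW_I.
    inverted⇒R : (∀ {w} → K.SameCoset w g → inv w t ≡ true) →
                 ∀ {w a b} → K.SameCoset w g → I.CosetLen w a → I.CosetLen (t ++ w) b → b < a
    inverted⇒R inverted w~g ((x , x~w , refl) , _) (_ , min)
      with exchange x t (inverted (K.~-trans (I⇒K x~w) w~g))
    ... | x′ , x′<x , e , _ = ℕ.≤-<-trans (min x′ (I.~-trans (I.≈⇒~ (≈-sym e)) (I.~-++ t x~w))) x′<x

    -- The mirror image: for a shortest y in twW_I, the element ty lies in gW_K and does not have t
    -- as an inversion. Hence y does, and exchange shortens it to a representative of wW_I.
    not-inverted⇒L : (∀ {w} → K.SameCoset w g → inv w t ≡ false) →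
                     ∀ {w a b} → K.SameCoset w g → I.CosetLen w a → I.CosetLen (t ++ w) b → a < b
    not-inverted⇒L not-inverted {w} w~g (_ , min) ((y , y~tw , refl) , _)
      with exchange y t inverted
      where
      ty~w : I.SameCoset (t ++ y) w
      ty~w = I.~-trans (I.~-++ t y~tw) (I.≈⇒~ (reflection-involutive r s w))
      inverted : inv y t ≡ true
      inverted = not-injective (trans (sym (inv-reflected r s y))
                                      (not-inverted (K.~-trans (I⇒K ty~w) w~g)))
    ... | y′ , y′<y , e , _ = ℕ.≤-<-trans
      (min y′ (I.~-trans (I.≈⇒~ (≈-sym e))
        (I.~-trans (I.~-++ t y~tw) (I.≈⇒~ (reflection-involutive r s w))))) y′<y

    -- If t moved gW_K, the parity would be constant there and all its cosets of W_I would lie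
    -- strictly on one side of t, against one of the two witnesses.
    both-sides⇒stable : ∀ {w₁ w₂} → K.SameCoset w₁ g → K.SameCoset w₂ g →
      I.L t w₁ ⊎ I.F t w₁ → I.R t w₂ ⊎ I.F t w₂ → K.SameCoset (t ++ g) g
    both-sides⇒stable w₁~g w₂~g LF RF with K.Finite._~?_ fin (t ++ g) g
    ... | yes stable = stable
    ... | no moved with inv g t in eq
    ...   | true = ⊥-elim (absurd LF)
      where
      shorter = inverted⇒R (λ w~g → trans (inv-const moved w~g) eq)
      absurd : _ → ⊥
      absurd (inj₁ (a , b , la , lb , a<b)) = ℕ.<-asym a<b (shorter w₁~g la lb)
      absurd (inj₂ (a , la , la′))          = ℕ.<-irrefl refl (shorter w₁~g la la′)
    ...   | false = ⊥-elim (absurd RF)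
      where
      longer = not-inverted⇒L (λ w~g → trans (inv-const moved w~g) eq)
      absurd : _ → ⊥
      absurd (inj₁ (a , b , la , lb , b<a)) = ℕ.<-asym b<a (longer w₂~g la lb)
      absurd (inj₂ (a , la , la′))          = ℕ.<-irrefl refl (longer w₂~g la la′)

    fold-back : K.SameCoset (t ++ g) g → ∀ {w} → K.SameCoset (t ++ w) g → K.SameCoset w g
    fold-back stable {w} tw~g =
      K.~-trans (K.≈⇒~ (≈-sym (reflection-involutive r s w))) (K.~-trans (K.~-++ t tw~g) stable)

  confined : ∀ {J} g → (∀ w → J w → K.SameCoset w g) → I.StrongPercolating J →
             ∀ w → K.SameCoset w g
  confined g J⊆g (I.done all) w = J⊆g w (all w)
  confined {J} g J⊆g (I.step J′ (r , s , fold , (w₁ , Jw₁ , LF) , (w₂ , Jw₂ , RF)) perc) =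
    confined g (J′⊆g fold) perc
    where
    -- Both witnesses of the step lie in gW_K, so t stabilises this coset and pulling back along the
    -- fold cannot leave it.
    back : ∀ {w} → K.SameCoset (reflection r s ++ w) g → K.SameCoset w g
    back = fold-back r s g (both-sides⇒stable r s g (J⊆g w₁ Jw₁) (J⊆g w₂ Jw₂) LF RF)
    J′⊆g : (J′ I.≐ (J I.⁺ reflection r s)) ⊎ (J′ I.≐ (J I.⁻ reflection r s)) →
           ∀ w → J′ w → K.SameCoset w g
    J′⊆g (inj₁ J′≐) w J′w with proj₁ (J′≐ w) J′w
    ... | inj₁ (_ , Jtw) = back (J⊆g _ Jtw)
    ... | inj₂ (_ , Jw)  = J⊆g w Jw
    J′⊆g (inj₂ J′≐) w J′w with proj₁ (J′≐ w) J′w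
    ... | inj₁ (_ , Jtw) = back (J⊆g _ Jtw)
    ... | inj₂ (_ , Jw)  = J⊆g w Jw

-- Minimal lengths of cosets

least : ∀ {P : ℕ → Set} → Decidable P → ∀ {k} → P k → ∃[ l ] P l × (∀ j → P j → l ≤ j)
least {P} P? {k} Pk = search k 0 (λ _ ()) (subst P (sym (ℕ.+-identityʳ k)) Pk)
  where
  -- Upward search from `a`; the sum `d + a` stays equal to the known solution, so `d` bounds the
  -- remaining steps.
  search : ∀ d a → (∀ j → j < a → ¬ P j) → P (d + a) → ∃[ l ] P l × (∀ j → P j → l ≤ j)
  search zero    a none Pa = a , Pa , λ j Pj → ℕ.≮⇒≥ λ j<a → none j j<a Pj
  search (suc d) a none Pd with P? a
  ... | yes Pa = a , Pa , λ j Pj → ℕ.≮⇒≥ λ j<a → none j j<a Pj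
  ... | no ¬Pa = search d (suc a) none′ (subst P (sym (ℕ.+-suc d a)) Pd)
    where
    none′ : ∀ j → j < suc a → ¬ P j
    none′ j j<1+a Pj with ℕ.m<1+n⇒m<n∨m≡n j<1+a
    ... | inj₁ j<a  = none j j<a Pj
    ... | inj₂ refl = ¬Pa Pj

anyOfLength? : ∀ {n} {P : List (Fin n) → Set} → Decidable P →
               ∀ k → Dec (∃[ u ] P u × length u ≡ k)
anyOfLength? P? zero    =
  map′ (λ p → [] , p , refl) (λ { ([] , p , _) → p }) (P? [])
anyOfLength? P? (suc k) =
  map′ (λ { (i , u , p , e) → i ∷ u , p , cong suc e })
       (λ { (i ∷ u , p , e) → i , u , p , ℕ.suc-injective e })
       (Fin.any? λ i → anyOfLength? (λ u → P? (i ∷ u)) k)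

module CosetLength {n : ℕ} (M : CoxeterMatrix n) (fin : Coxeter.IsFinite M) (I : Subset n) where
  open Words M
  open Cosets M I
  open Finite fin

  abstract
    cosetLen : ∀ w → ∃ (CosetLen w)
    cosetLen w with least (anyOfLength? (_~? w)) (w , ~-refl , refl)
    ... | l , shortest , min = l , shortest , λ u u~w → min (length u) (u , u~w , refl)

  len : Word → ℕ
  len w = proj₁ (cosetLen w)

  len-min : ∀ {u w} → SameCoset u w → len w ≤ length u
  len-min {u} {w} = proj₂ (proj₂ (cosetLen w)) u

  len-attained : ∀ w → ∃[ u ] SameCoset u w × length u ≡ len w
  len-attained w = proj₁ (proj₂ (cosetLen w))

  CosetLen⇒≡ : ∀ {w k} → CosetLen w k → k ≡ len w
  CosetLen⇒≡ {w} ((u , u~w , refl) , min) with len-attained w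
  ... | v , v~w , e = ℕ.≤-antisym (subst (length u ≤_) e (min v v~w)) (len-min u~w)

  len-mono : ∀ {w x} → SameCoset w x → len w ≤ len x
  len-mono {w} {x} w~x with len-attained x
  ... | v , v~x , e = subst (len w ≤_) e (len-min (~-trans v~x (~-sym w~x)))

  len-cong : ∀ {w x} → SameCoset w x → len w ≡ len x
  len-cong w~x = ℕ.≤-antisym (len-mono w~x) (len-mono (~-sym w~x))

  len-∷ : ∀ i w → len (i ∷ w) ≤ suc (len w)
  len-∷ i w with len-attained w
  ... | v , v~w , e = subst (λ k → len (i ∷ w) ≤ suc k) e (len-min (~-++ [ i ] v~w))

  len-tail : ∀ i w → len w ≤ suc (len (i ∷ w))
  len-tail i w = ℕ.≤-trans (len-mono (≈⇒~ (≈-sym (cancel i w)))) (len-∷ i (i ∷ w))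

  len≡0⇒~ : ∀ {w} → len w ≡ 0 → SameCoset w []
  len≡0⇒~ {w} e with len-attained w
  ... | []    , []~w , _  = ~-sym []~w
  ... | _ ∷ _ , _    , e′ = contradiction (trans e′ e) λ ()

  ~⇒len≡0 : ∀ {w} → SameCoset w [] → len w ≡ 0
  ~⇒len≡0 w~[] = ℕ.n≤0⇒n≡0 (len-min (~-sym w~[]))

  -- Strip the first letter of a shortest representative.
  descent : ∀ {k w} → len w ≡ suc k → ∃[ i ] len (i ∷ w) ≤ k × len (i ∷ w) < len w
  descent {k} {w} e with len-attained w
  ... | []    , _   , e′ = contradiction (trans e′ e) λ ()
  ... | i ∷ v , iv~w , e′ = i , bound , subst (len (i ∷ w) <_) (sym e) (s≤s bound)
    where
    v~iw : SameCoset v (i ∷ w)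
    v~iw = ~-trans (≈⇒~ (≈-sym (cancel i v))) (~-++ [ i ] iv~w)
    bound : len (i ∷ w) ≤ k
    bound = subst (len (i ∷ w) ≤_) (ℕ.suc-injective (trans e′ e)) (len-min v~iw)

  -- The sum of the lengths over a finite list covering W is a crude common bound.
  len-bounded : ∃[ N ] ∀ w → len w ≤ N
  len-bounded = bounded (proj₁ fin) (proj₂ fin)
    where
    bound : ∀ {w} vs → Any (w ≈_) vs → len w ≤ sum (map len vs)
    bound {w} (v ∷ vs) (here w≈v) = ℕ.≤-trans (len-mono (≈⇒~ w≈v)) (ℕ.m≤m+n (len v) _)
    bound (v ∷ vs) (there p)  = ℕ.≤-trans (bound vs p) (ℕ.m≤n+m _ (len v))
    bounded : ∀ vs → (∀ w → Any (w ≈_) vs) → ∃[ N ] ∀ w → len w ≤ N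
    bounded vs cover = _ , λ w → bound vs (cover w)

  shortens⇒R : ∀ {t w} → len (t ++ w) < len w → R t w
  shortens⇒R {t} {w} lt = len w , len (t ++ w) , proj₂ (cosetLen w) , proj₂ (cosetLen (t ++ w)) , lt

  R⇒shortens : ∀ {t w} → R t w → len (t ++ w) < len w
  R⇒shortens (a , b , la , lb , b<a) with CosetLen⇒≡ la | CosetLen⇒≡ lb
  ... | refl | refl = b<a

  lengthens⇒L : ∀ {t w} → len w < len (t ++ w) → L t w
  lengthens⇒L {t} {w} lt = len w , len (t ++ w) , proj₂ (cosetLen w) , proj₂ (cosetLen (t ++ w)) , lt

  L⇒lengthens : ∀ {t w} → L t w → len w < len (t ++ w)
  L⇒lengthens (a , b , la , lb , a<b) with CosetLen⇒≡ la | CosetLen⇒≡ lb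
  ... | refl | refl = a<b

  same⇒F : ∀ {t w} → len (t ++ w) ≡ len w → F t w
  same⇒F {t} {w} e = len w , proj₂ (cosetLen w) , subst (CosetLen (t ++ w)) e (proj₂ (cosetLen (t ++ w)))

  R? : ∀ t w → Dec (R t w)
  R? t w = map′ (shortens⇒R {t}) (R⇒shortens {t}) (len (t ++ w) ℕ.<? len w)

-- Percolation when a single generator lies outside `I`

module Maximal {n : ℕ} (M : CoxeterMatrix n) (fin : Coxeter.IsFinite M) (I : Subset n)
               (s : Fin n) (others∈I : ∀ i → i ≢ s → i ∈ I) where
  open Words M
  open Cosets M I
  open CosetLength M fin I

  I∨s : ∀ i → i ∈ I ⊎ i ≡ s
  I∨s i with i Fin.≟ s
  ... | yes i≡s = inj₂ i≡s
  ... | no  i≢s = inj₁ (others∈I i i≢s)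

  -- Removes the degenerate case: if s lay in W_I there would be only one coset, and no starting
  -- pair.
  s~[]⇒trivial : SameCoset [ s ] [] → ∀ w → SameCoset w []
  s~[]⇒trivial s~[] []      = ~-refl
  s~[]⇒trivial s~[] (i ∷ w) = ~-trans (~-++ [ i ] (s~[]⇒trivial s~[] w)) ([i]~[] (I∨s i))
    where
    [i]~[] : i ∈ I ⊎ i ≡ s → SameCoset [ i ] []
    [i]~[] (inj₁ i∈I)  = ~-absorb i∈I
    [i]~[] (inj₂ refl) = s~[]

  -- A `CSet` is a predicate on words that need not respect cosets, so containing a coset means
  -- containing every word that represents it.
  _⊇[_] : CSet → Word → Set
  J ⊇[ x ] = ∀ y → SameCoset y x → J y

  plus-⊇[[]] : ∀ {J} t → J ⊇[ [] ] → (J ⁺ t) ⊇[ [] ]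
  plus-⊇[[]] t J∋ y y~ = inj₂ (¬R , J∋ y y~)
    where
    ¬R : ¬ R t y
    ¬R r = ℕ.n≮0 (subst (len (t ++ y) <_) (~⇒len≡0 y~) (R⇒shortens {t} r))

  module Nontrivial (s≁[] : ¬ SameCoset [ s ] []) where

    len-s : len [ s ] ≡ 1
    len-s with len [ s ] in e | len-min (~-refl {[ s ]})
    ... | zero  | _       = contradiction (len≡0⇒~ e) s≁[]
    ... | suc _ | s≤s z≤n = refl

    F-[] : ∀ {i} → i ∈ I → F [ i ] []
    F-[] i∈I = same⇒F {[ _ ]} (len-cong (~-absorb i∈I))

    LF-[] : ∀ i → L [ i ] [] ⊎ F [ i ] []
    LF-[] i with I∨s i
    ... | inj₁ i∈I  = inj₂ (F-[] i∈I)
    ... | inj₂ refl = inj₁ (lengthens⇒L {[ s ]} (subst (_< len [ s ]) (sym (~⇒len≡0 ~-refl))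
                              (subst (0 <_) (sym len-s) (s≤s z≤n))))

    R-s : R [ s ] [ s ]
    R-s = shortens⇒R {[ s ]} (subst (len (s ∷ s ∷ []) <_) (sym len-s)
            (s≤s (ℕ.≤-reflexive (~⇒len≡0 (≈⇒~ (involutive s))))))

    -- The trivial coset is a witness on the left for every i. On the right it serves again when i ∈
    -- I fixes it, and sW_I serves when i = s.
    plus-fold : ∀ {J} i → J ⊇[ [] ] → J ⊇[ [ s ] ] → StrongPercolating (J ⁺ [ i ]) → StrongPercolating J
    plus-fold {J} i J∋[] J∋s =
      step (J ⁺ [ i ]) ([] , i , inj₁ (λ w → (λ p → p) , (λ p → p)) ,
                        ([] , J∋[] [] ~-refl , LF-[] i) , right (I∨s i))
      where
      right : i ∈ I ⊎ i ≡ s → ∃[ w ] J w × (R [ i ] w ⊎ F [ i ] w)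
      right (inj₁ i∈I)  = [] , J∋[] [] ~-refl , inj₂ (F-[] i∈I)
      right (inj₂ refl) = [ s ] , J∋s [ s ] ~-refl , inj₁ R-s

    -- The cosets that the plus-folds along the generators in X bring into a set
    -- already containing all cosets of length at most k.
    Reach : ℕ → List (Fin n) → Word → Set
    Reach k X y = len y ≤ k ⊎ (∃[ i ] i ∈ᴸ X × len (i ∷ y) ≤ k)

    -- Every coset in reach has length at most k + 1. If i shortens it, its image has length at most
    -- k and is in J already. If not, being reached through i means that its own length is at most
    -- k.
    Reach-fold : ∀ {J k X} i → (∀ y → Reach k X y → J y) → ∀ y → Reach k (i ∷ X) y → (J ⁺ [ i ]) y
    Reach-fold {J} {k} {X} i J⊇ y reach with R? [ i ] y
    ... | yes r = inj₁ (r , J⊇ (i ∷ y) (inj₁ (ℕ.≤-pred (ℕ.<-≤-trans (R⇒shortens {[ i ]} r) (bound reach)))))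
      where
      bound : Reach k (i ∷ X) y → len y ≤ suc k
      bound (inj₁ y≤k)            = ℕ.m≤n⇒m≤1+n y≤k
      bound (inj₂ (j , _ , jy≤k)) = ℕ.≤-trans (len-tail j y) (s≤s jy≤k)
    ... | no ¬r = inj₂ (¬r , J⊇ y (unfolded reach))
      where
      unfolded : Reach k (i ∷ X) y → Reach k X y
      unfolded (inj₁ y≤k)                       = inj₁ y≤k
      unfolded (inj₂ (j , there j∈X , jy≤k))    = inj₂ (j , j∈X , jy≤k)
      unfolded (inj₂ (j , here refl , jy≤k))    =
        inj₁ (ℕ.≤-trans (ℕ.≮⇒≥ (¬r ∘ shortens⇒R {[ i ]})) jy≤k)

    -- One round of folds, with `X` the generators already used and `is` those to come. After the
    -- round every coset of length k + 1 is present, because its descent is in `X`; `continue` then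
    -- takes over.
    sweep : ∀ {k} is X → (∀ i → i ∈ᴸ is ⊎ i ∈ᴸ X) →
            (∀ J → J ⊇[ [ s ] ] → (∀ y → len y ≤ suc k → J y) → StrongPercolating J) →
            ∀ J → J ⊇[ [ s ] ] → (∀ y → Reach k X y → J y) → StrongPercolating J
    sweep {k} [] X all continue J J∋s J⊇ = continue J J∋s larger
      where
      larger : ∀ y → len y ≤ suc k → J y
      larger y y≤ with ℕ.m≤n⇒m<n∨m≡n y≤
      ... | inj₁ y<    = J⊇ y (inj₁ (ℕ.≤-pred y<))
      ... | inj₂ y≡ with descent y≡
      ...   | i , iy≤k , _ with all i
      ...     | inj₂ i∈X = J⊇ y (inj₂ (i , i∈X , iy≤k))
    sweep {k} (i ∷ is) X all continue J J∋s J⊇ =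
      plus-fold i J∋[] J∋s (sweep is (i ∷ X) all′ continue (J ⁺ [ i ]) J′∋s (Reach-fold i J⊇))
      where
      J∋[] : J ⊇[ [] ]
      J∋[] y y~ = J⊇ y (inj₁ (subst (_≤ k) (sym (~⇒len≡0 y~)) z≤n))
      all′ : ∀ j → j ∈ᴸ is ⊎ j ∈ᴸ (i ∷ X)
      all′ j with all j
      ... | inj₁ (here j≡i)   = inj₂ (here j≡i)
      ... | inj₁ (there j∈is) = inj₁ j∈is
      ... | inj₂ j∈X          = inj₂ (there j∈X)
      J′∋s : (J ⁺ [ i ]) ⊇[ [ s ] ]
      J′∋s y y~s with R? [ i ] y
      ... | no ¬r = inj₂ (¬r , J∋s y y~s)
      -- A coset of length 1 that gets shorter becomes the trivial coset.
      ... | yes r = inj₁ (r , J∋[] (i ∷ y) (len≡0⇒~ (ℕ.n<1⇒n≡0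
                      (subst (len (i ∷ y) <_) (trans (len-cong y~s) len-s) (R⇒shortens {[ i ]} r)))))

    -- `d` counts the rounds left: each sweep moves one unit from `d` to `k`, and at `d` = 0 no
    -- coset is longer than `k`.
    percolate : ∀ d k → (∀ w → len w ≤ d + k) →
                ∀ J → J ⊇[ [ s ] ] → (∀ y → len y ≤ k → J y) → StrongPercolating J
    percolate zero    k bound J J∋s J⊇ = done λ w → J⊇ w (bound w)
    percolate (suc d) k bound J J∋s J⊇ =
      sweep (allFin n) [] (λ i → inj₁ (∈-allFin i))
            (percolate d (suc k) (λ w → subst (len w ≤_) (sym (ℕ.+-suc d k)) (bound w)))
            J J∋s λ { y (inj₁ y≤k) → J⊇ y y≤k ; y (inj₂ (_ , () , _)) }

    percolate-[]s : ∀ J → J ⊇[ [] ] → J ⊇[ [ s ] ] → StrongPercolating J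
    percolate-[]s J J∋[] J∋s =
      percolate (proj₁ len-bounded) 0
        (λ w → subst (len w ≤_) (sym (ℕ.+-identityʳ _)) (proj₂ len-bounded w))
        J J∋s λ y y≤0 → J∋[] y (len≡0⇒~ (ℕ.n≤0⇒n≡0 y≤0))

    -- The recursion is on the bound `k` and not on `x`, since `i ∷ x` is a longer word for a
    -- shorter coset.
    lower : ∀ k x → len x ≤ k → ¬ SameCoset x [] →
            ∀ J → J ⊇[ [] ] → J ⊇[ x ] → StrongPercolating J
    lower k x x≤k x≁[] J J∋[] J∋x with len x in e
    ... | zero  = contradiction (len≡0⇒~ e) x≁[]
    lower (suc k) x (s≤s l≤k) x≁[] J J∋[] J∋x | suc l with descent e
    ... | i , ix≤l , ix<x with I∨s i
    -- Since s shortens x, the coset xW_I is the right witness; the left fold then adds sW_I, which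
    -- s sends to W_I.
    ... | inj₂ refl =
      step (J ⁺ [ s ]) ([] , s , inj₁ (λ w → (λ p → p) , (λ p → p)) ,
                        ([] , J∋[] [] ~-refl , LF-[] s) ,
                        (x , J∋x x ~-refl , inj₁ (shortens⇒R {[ s ]} ix<x)))
           (percolate-[]s (J ⁺ [ s ]) (plus-⊇[[]] [ s ] J∋[]) J′∋s)
      where
      J′∋s : (J ⁺ [ s ]) ⊇[ [ s ] ]
      J′∋s y y~s = inj₁ (shortens⇒R {[ s ]} shorter , J∋[] (s ∷ y) sy~[])
        where
        sy~[] : SameCoset (s ∷ y) []
        sy~[] = ~-trans (~-++ [ s ] y~s) (≈⇒~ (involutive s))
        shorter : len (s ∷ y) < len y
        shorter = subst (len (s ∷ y) <_) (sym (trans (len-cong y~s) len-s))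
                        (s≤s (ℕ.≤-reflexive (~⇒len≡0 sy~[])))
    -- The trivial coset is fixed by i and so witnesses both sides at once; the right fold replaces
    -- x by the shorter ix.
    ... | inj₁ i∈I =
      step (J ⁻ [ i ]) ([] , i , inj₂ (λ w → (λ p → p) , (λ p → p)) ,
                        ([] , J∋[] [] ~-refl , inj₂ (F-[] i∈I)) ,
                        ([] , J∋[] [] ~-refl , inj₂ (F-[] i∈I)))
           (lower k (i ∷ x) (ℕ.≤-trans ix≤l l≤k) ix≁[] (J ⁻ [ i ]) J′∋[] J′∋ix)
      where
      ix≁[] : ¬ SameCoset (i ∷ x) []
      ix≁[] ix~[] = x≁[] (~-trans (≈⇒~ (≈-sym (cancel i x)))
                                  (~-trans (~-++ [ i ] ix~[]) (~-absorb i∈I)))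
      J′∋[] : (J ⁻ [ i ]) ⊇[ [] ]
      J′∋[] y y~[] = inj₂ (¬L , J∋[] y y~[])
        where
        ¬L : ¬ L [ i ] y
        ¬L l = ℕ.n≮0 (subst (len y <_) (~⇒len≡0 (~-trans (~-++ [ i ] y~[]) (~-absorb i∈I)))
                            (L⇒lengthens {[ i ]} l))
      J′∋ix : (J ⁻ [ i ]) ⊇[ i ∷ x ]
      J′∋ix y y~ix = inj₁ (lengthens⇒L {[ i ]} longer , J∋x (i ∷ y) iy~x)
        where
        iy~x : SameCoset (i ∷ y) x
        iy~x = ~-trans (~-++ [ i ] y~ix) (≈⇒~ (cancel i x))
        longer : len y < len (i ∷ y)
        longer = subst (len y <_) (sym (len-cong iy~x)) (subst (_< len x) (sym (len-cong y~ix)) ix<x)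

  strongly-percolates : StronglyPercolates
  strongly-percolates w w≁[] =
    lower (len w) w ℕ.≤-refl w≁[] (pair w) (λ _ → inj₁) (λ _ → inj₂)
    where
    open Nontrivial (λ s~[] → w≁[] (s~[]⇒trivial s~[] w))

-- Orbit sums of integer-valued functions

module _ {A : Set} where

  -- The operator 1 + σ + ⋯ + σ^(k-1), with σ acting on functions by precomposition.
  orbitSum : ℕ → (A → A) → (A → ℤ) → A → ℤ
  orbitSum zero    σ f v = 0ℤ
  orbitSum (suc k) σ f v = f v +ᶻ orbitSum k σ f (σ v)

  iterate : ℕ → (A → A) → A → A
  iterate zero    σ v = v
  iterate (suc k) σ v = iterate k σ (σ v)

  orbitSum-cong : ∀ k σ {f g : A → ℤ} → (∀ v → f v ≡ g v) → ∀ v → orbitSum k σ f v ≡ orbitSum k σ g v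
  orbitSum-cong zero    σ e v = refl
  orbitSum-cong (suc k) σ e v = cong₂ _+ᶻ_ (e v) (orbitSum-cong k σ e (σ v))

  orbitSum-0 : ∀ k σ v → orbitSum k σ (λ _ → 0ℤ) v ≡ 0ℤ
  orbitSum-0 zero    σ v = refl
  orbitSum-0 (suc k) σ v = trans (ℤ.+-identityˡ _) (orbitSum-0 k σ (σ v))

  orbitSum-+ : ∀ k σ f g v →
    orbitSum k σ (λ w → f w +ᶻ g w) v ≡ orbitSum k σ f v +ᶻ orbitSum k σ g v
  orbitSum-+ zero    σ f g v = refl
  orbitSum-+ (suc k) σ f g v = trans (cong ((f v +ᶻ g v) +ᶻ_) (orbitSum-+ k σ f g (σ v)))
    (shuffle (f v) (g v) (orbitSum k σ f (σ v)) (orbitSum k σ g (σ v)))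
    where
    shuffle : ∀ a b c d → (a +ᶻ b) +ᶻ (c +ᶻ d) ≡ (a +ᶻ c) +ᶻ (b +ᶻ d)
    shuffle = solve-∀

  orbitSum-neg : ∀ k σ f v → orbitSum k σ (λ w → - f w) v ≡ - orbitSum k σ f v
  orbitSum-neg zero    σ f v = refl
  orbitSum-neg (suc k) σ f v =
    trans (cong (- f v +ᶻ_) (orbitSum-neg k σ f (σ v))) (sym (ℤ.neg-distrib-+ (f v) _))

  orbitSum-∘ : ∀ k {σ τ : A → A} → (∀ v → σ (τ v) ≡ τ (σ v)) → ∀ (f : A → ℤ) v →
               orbitSum k σ (f ∘ τ) v ≡ orbitSum k σ f (τ v)
  orbitSum-∘ zero    comm f v = refl
  orbitSum-∘ (suc k) {σ} comm f v = cong (f _ +ᶻ_)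
    (trans (orbitSum-∘ k comm f (σ v)) (cong (orbitSum k σ f) (sym (comm v))))

  orbitSum-last : ∀ k σ f v → orbitSum (suc k) σ f v ≡ orbitSum k σ f v +ᶻ f (iterate k σ v)
  orbitSum-last zero    σ f v = ℤ.+-comm (f v) 0ℤ
  orbitSum-last (suc k) σ f v =
    trans (cong (f v +ᶻ_) (orbitSum-last k σ f (σ v))) (sym (ℤ.+-assoc (f v) _ _))

  Vanishing : ℕ → (A → A) → (A → ℤ) → Set
  Vanishing k σ f = ∀ v → orbitSum k σ f v ≡ 0ℤ

  -- This is σ^k - 1 = (σ - 1)(1 + σ + ⋯ + σ^(k-1)).
  vanishing⇒periodic : ∀ k σ f → Vanishing k σ f → ∀ v → f (iterate k σ v) ≡ f v
  vanishing⇒periodic k σ f van v = begin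
    f (iterate k σ v)                      ≡⟨ ℤ.+-identityˡ _ ⟨
    0ℤ +ᶻ f (iterate k σ v)                ≡⟨ cong (_+ᶻ f (iterate k σ v)) (van v) ⟨
    orbitSum k σ f v +ᶻ f (iterate k σ v)  ≡⟨ orbitSum-last k σ f v ⟨
    f v +ᶻ orbitSum k σ f (σ v)            ≡⟨ cong (f v +ᶻ_) (van (σ v)) ⟩
    f v +ᶻ 0ℤ                              ≡⟨ ℤ.+-identityʳ (f v) ⟩
    f v                                    ∎
    where open ≡-Reasoning

  -- After k steps the recursion gives d₀∘σ^k plus the orbit sum of c; the first is d₀ by
  -- periodicity and the second is 0.
  affine-periodic : ∀ k σ (c : A → ℤ) (d : ℕ → A → ℤ) →
    (∀ l v → d (suc l) v ≡ d l (σ v) +ᶻ c v) → Vanishing k σ c → Vanishing k σ (d 0) → d k ≗ d 0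
  affine-periodic k σ c d rec van-c van-d v = begin
    d k v                                     ≡⟨ closed k v ⟩
    d 0 (iterate k σ v) +ᶻ orbitSum k σ c v   ≡⟨ cong₂ _+ᶻ_ (vanishing⇒periodic k σ (d 0) van-d v) (van-c v) ⟩
    d 0 v +ᶻ 0ℤ                               ≡⟨ ℤ.+-identityʳ (d 0 v) ⟩
    d 0 v                                     ∎
    where
    open ≡-Reasoning
    closed : ∀ l v → d l v ≡ d 0 (iterate l σ v) +ᶻ orbitSum l σ c v
    closed zero    v = sym (ℤ.+-identityʳ (d 0 v))
    closed (suc l) v = begin
      d (suc l) v                                                     ≡⟨ rec l v ⟩
      d l (σ v) +ᶻ c v                                                ≡⟨ cong (_+ᶻ c v) (closed l (σ v)) ⟩
      (d 0 (iterate l σ (σ v)) +ᶻ orbitSum l σ c (σ v)) +ᶻ c v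
        ≡⟨ shuffle (d 0 (iterate l σ (σ v))) (orbitSum l σ c (σ v)) (c v) ⟩
      d 0 (iterate l σ (σ v)) +ᶻ (c v +ᶻ orbitSum l σ c (σ v))        ∎
      where
      shuffle : ∀ a b c → (a +ᶻ b) +ᶻ c ≡ a +ᶻ (c +ᶻ b)
      shuffle = solve-∀

  -- On an invariant function the orbit sum is multiplication by k, and ℤ has no torsion. So the
  -- root of unity ζ² does not have 1 as an eigenvalue.
  vanishing-invariant⇒0 : ∀ k .{{_ : NonZero k}} σ f → Vanishing k σ f → (∀ v → f (σ v) ≡ f v) → ∀ v → f v ≡ 0ℤ
  vanishing-invariant⇒0 k@(suc _) σ f van inv v =
    ℤ.*-cancelˡ-≡ (+ k) (f v) 0ℤ (trans (sym (multiple k v)) (trans (van v) (sym (ℤ.*-zeroʳ (+ k)))))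
    where
    multiple : ∀ l v → orbitSum l σ f v ≡ + l *ᶻ f v
    multiple zero    v = refl
    multiple (suc l) v = trans (cong (f v +ᶻ_) (trans (multiple l (σ v)) (cong (+ l *ᶻ_) (inv v))))
                               (sym (ℤ.suc-* (+ l) (f v)))

  telescope : ∀ k σ (h : A → ℤ) v → orbitSum k σ (λ w → h w -ᶻ h (σ w)) v ≡ h v -ᶻ h (iterate k σ v)
  telescope zero    σ h v = sym (ℤ.+-inverseʳ (h v))
  telescope (suc k) σ h v =
    trans (cong (h v -ᶻ h (σ v) +ᶻ_) (telescope k σ h (σ v)))
          (collapse (h v) (h (σ v)) (h (iterate k σ (σ v))))
    where
    collapse : ∀ a b c → (a -ᶻ b) +ᶻ (b -ᶻ c) ≡ a -ᶻ c
    collapse = solve-∀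

-- Lattice functions on which shifts act as roots of unity

module Lattice (r : ℕ) (q : Fin r → ℕ) where

  A : Set
  A = Vec ℤ r

  shift : ∀ {r} → Fin r → ℤ → Vec ℤ r → Vec ℤ r
  shift p z v = updateAt v p (z +ᶻ_)

  up dn : Fin r → A → A
  up p = shift p 1ℤ
  dn p = shift p (- 1ℤ)

  shift-comm : ∀ p p′ z z′ (v : A) → shift p z (shift p′ z′ v) ≡ shift p′ z′ (shift p z v)
  shift-comm p p′ z z′ v with p Fin.≟ p′
  ... | no p≢p′  = updateAt-commutes p p′ p≢p′ v
  ... | yes refl = trans (updateAt-updateAt-local p {h = λ x → z′ +ᶻ (z +ᶻ x)} v (swap z z′ _))
                         (sym (updateAt-updateAt-local p v refl))
    where
    swap : ∀ a b c → a +ᶻ (b +ᶻ c) ≡ b +ᶻ (a +ᶻ c)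
    swap = solve-∀

  up-dn : ∀ p v → up p (dn p v) ≡ v
  up-dn p v = trans (updateAt-updateAt-local p {h = λ x → 1ℤ +ᶻ (- 1ℤ +ᶻ x)} v refl)
    (updateAt-id-local p v (cancels _))
    where
    cancels : ∀ a → 1ℤ +ᶻ (- 1ℤ +ᶻ a) ≡ a
    cancels = solve-∀

  dn-up : ∀ p v → dn p (up p v) ≡ v
  dn-up p v = trans (shift-comm p p (- 1ℤ) 1ℤ v) (up-dn p v)

  -- On these functions `up p` acts as a root of unity ζ such that 1 + ζ² + ⋯ + ζ^(2(q p − 1)) = 0.
  record Cyclotomic (f : A → ℤ) : Set where
    field
      up-vanishing : ∀ p → Vanishing (q p) (up p ∘ up p) f
      dn-vanishing : ∀ p → Vanishing (q p) (dn p ∘ dn p) f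
  open Cyclotomic public

  cyclotomic-0 : Cyclotomic (λ _ → 0ℤ)
  cyclotomic-0 = record
    { up-vanishing = λ p → orbitSum-0 (q p) _
    ; dn-vanishing = λ p → orbitSum-0 (q p) _ }

  cyclotomic-+ : ∀ {f g} → Cyclotomic f → Cyclotomic g → Cyclotomic (λ v → f v +ᶻ g v)
  cyclotomic-+ cf cg = record
    { up-vanishing = λ p v → trans (orbitSum-+ (q p) _ _ _ v) (cong₂ _+ᶻ_ (up-vanishing cf p v) (up-vanishing cg p v))
    ; dn-vanishing = λ p v → trans (orbitSum-+ (q p) _ _ _ v) (cong₂ _+ᶻ_ (dn-vanishing cf p v) (dn-vanishing cg p v)) }

  cyclotomic-neg : ∀ {f} → Cyclotomic f → Cyclotomic (λ v → - f v)
  cyclotomic-neg cf = record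
    { up-vanishing = λ p v → trans (orbitSum-neg (q p) _ _ v) (cong -_ (up-vanishing cf p v))
    ; dn-vanishing = λ p v → trans (orbitSum-neg (q p) _ _ v) (cong -_ (dn-vanishing cf p v)) }

  -- Shifts commute, so orbit sums pass through them.
  cyclotomic-shift : ∀ {f} p z → Cyclotomic f → Cyclotomic (λ v → f (shift p z v))
  cyclotomic-shift {f} p z cf = record
    { up-vanishing = λ p′ → vanishing p′ 1ℤ (up-vanishing cf p′)
    ; dn-vanishing = λ p′ → vanishing p′ (- 1ℤ) (dn-vanishing cf p′) }
    where
    vanishing : ∀ p′ z′ → Vanishing (q p′) (shift p′ z′ ∘ shift p′ z′) f →
                Vanishing (q p′) (shift p′ z′ ∘ shift p′ z′) (f ∘ shift p z)
    vanishing p′ z′ van v = trans (orbitSum-∘ (q p′) comm² f v) (van (shift p z v))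
      where
      comm² : ∀ v → shift p′ z′ (shift p′ z′ (shift p z v)) ≡ shift p z (shift p′ z′ (shift p′ z′ v))
      comm² v = trans (cong (shift p′ z′) (shift-comm p′ p z′ z v)) (shift-comm p′ p z′ z (shift p′ z′ v))

-- An explicit nonzero cyclotomic function

multiple? : ∀ q x → Dec (+ (2 * q) ℤ∣.∣ x)
multiple? q x = + (2 * q) ℤ∣.∣? x

indicator : ℕ → ℤ → ℤ
indicator q x = if does (multiple? q x) then 1ℤ else 0ℤ

up² dn² : ℤ → ℤ
up² x = 1ℤ +ᶻ (1ℤ +ᶻ x)
dn² x = - 1ℤ +ᶻ (- 1ℤ +ᶻ x)

dn²-up² : ∀ x → dn² (up² x) ≡ x
dn²-up² = cancels
  where
  cancels : ∀ x → - 1ℤ +ᶻ (- 1ℤ +ᶻ (1ℤ +ᶻ (1ℤ +ᶻ x))) ≡ x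
  cancels = solve-∀

up²-dn² : ∀ x → up² (dn² x) ≡ x
up²-dn² = cancels
  where
  cancels : ∀ x → 1ℤ +ᶻ (1ℤ +ᶻ (- 1ℤ +ᶻ (- 1ℤ +ᶻ x))) ≡ x
  cancels = solve-∀

-- As `indicator q` has period 2q, the sums of q terms of its differences with step 2 telescope to 0.
wave : ℕ → ℤ → ℤ
wave q x = indicator q x -ᶻ indicator q (up² x)

iterate-up² : ∀ k x → iterate k up² x ≡ + (2 * k) +ᶻ x
iterate-up² zero    x = sym (ℤ.+-identityˡ x)
iterate-up² (suc k) x = begin
  iterate k up² (up² x)          ≡⟨ iterate-up² k (up² x) ⟩
  + (2 * k) +ᶻ up² x             ≡⟨ shuffle (+ (2 * k)) x ⟩
  (+ 2 +ᶻ + (2 * k)) +ᶻ x        ≡⟨ cong (λ l → + l +ᶻ x) (ℕ.*-suc 2 k) ⟨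
  + (2 * suc k) +ᶻ x             ∎
  where
  open ≡-Reasoning
  shuffle : ∀ a b → a +ᶻ (1ℤ +ᶻ (1ℤ +ᶻ b)) ≡ (+ 2 +ᶻ a) +ᶻ b
  shuffle = solve-∀

indicator-periodic : ∀ q x → indicator q (iterate q up² x) ≡ indicator q x
indicator-periodic q x = trans (cong (indicator q) (iterate-up² q x))
  (cong (λ b → if b then 1ℤ else 0ℤ) (does-⇔
    (mk⇔ (λ d → ℤ∣.∣m+n∣m⇒∣n d ℤ∣.∣-refl) (ℤ∣.∣m∣n⇒∣m+n ℤ∣.∣-refl))
    (multiple? q (+ (2 * q) +ᶻ x)) (multiple? q x)))

iterate-inverse : ∀ {A : Set} {σ τ : A → A} → (∀ v → σ (τ v) ≡ v) → ∀ k v → iterate k σ (iterate k τ v) ≡ v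
iterate-inverse στ zero    v = refl
iterate-inverse {σ = σ} {τ} στ (suc k) v = begin
  iterate k σ (σ (iterate k τ (τ v)))   ≡⟨ cong (iterate k σ ∘ σ) (outer k v) ⟩
  iterate k σ (σ (τ (iterate k τ v)))   ≡⟨ cong (iterate k σ) (στ _) ⟩
  iterate k σ (iterate k τ v)           ≡⟨ iterate-inverse στ k v ⟩
  v                                     ∎
  where
  open ≡-Reasoning
  outer : ∀ k v → iterate k τ (τ v) ≡ τ (iterate k τ v)
  outer zero    v = refl
  outer (suc k) v = outer k (τ v)

wave-up² : ∀ q → Vanishing q up² (wave q)
wave-up² q x = begin
  orbitSum q up² (wave q) x                         ≡⟨ telescope q up² (indicator q) x ⟩
  indicator q x -ᶻ indicator q (iterate q up² x)    ≡⟨ cong (indicator q x -ᶻ_) (indicator-periodic q x) ⟩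
  indicator q x -ᶻ indicator q x                    ≡⟨ ℤ.+-inverseʳ (indicator q x) ⟩
  0ℤ                                                ∎
  where open ≡-Reasoning

-- Seen from y + 2, the wave is minus the difference taken downwards, which telescopes along the
-- reversed orbit.
wave-dn² : ∀ q → Vanishing q dn² (wave q)
wave-dn² q x = begin
  orbitSum q dn² (wave q) x                         ≡⟨ orbitSum-cong q dn² flip x ⟩
  orbitSum q dn² (λ y → - (down-wave (up² y))) x    ≡⟨ orbitSum-neg q dn² (down-wave ∘ up²) x ⟩
  - orbitSum q dn² (down-wave ∘ up²) x
    ≡⟨ cong -_ (orbitSum-∘ q (λ v → trans (dn²-up² v) (sym (up²-dn² v))) down-wave x) ⟩
  - orbitSum q dn² down-wave (up² x)                ≡⟨ cong -_ (telescope q dn² (indicator q) (up² x)) ⟩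
  - (indicator q (up² x) -ᶻ indicator q (iterate q dn² (up² x)))
    ≡⟨ cong (λ z → - (indicator q (up² x) -ᶻ z))
            (trans (sym (indicator-periodic q _)) (cong (indicator q) (iterate-inverse up²-dn² q (up² x)))) ⟩
  - (indicator q (up² x) -ᶻ indicator q (up² x))    ≡⟨ cong -_ (ℤ.+-inverseʳ (indicator q (up² x))) ⟩
  0ℤ                                                ∎
  where
  open ≡-Reasoning
  down-wave : ℤ → ℤ
  down-wave y = indicator q y -ᶻ indicator q (dn² y)
  flip : ∀ y → wave q y ≡ - down-wave (up² y)
  flip y = trans (negate (indicator q y) (indicator q (up² y)))
                 (cong (λ z → - (indicator q (up² y) -ᶻ indicator q z)) (sym (dn²-up² y)))
    where
    negate : ∀ a b → a -ᶻ b ≡ - (b -ᶻ a)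
    negate = solve-∀

-- As 2q ≥ 4, it does not divide 2, so only the first indicator contributes.
wave-0 : ∀ q → 2 ≤ q → wave q 0ℤ ≡ 1ℤ
wave-0 q 2≤q rewrite dec-true (multiple? q 0ℤ) (ℤ∣.divides 0ℤ refl)
                   | dec-false (multiple? q (+ 2)) (λ d → ℕ.<-irrefl refl
                       (ℕ.≤-trans (s≤s (s≤s (s≤s z≤n))) (ℕ.≤-trans (ℕ.*-monoʳ-≤ 2 2≤q) (∣⇒≤ (ℤ∣.∣⇒∣ᵤ d))))) = refl

-- One wave per coordinate, multiplied, so that all shifts satisfy their cyclotomic relations
-- simultaneously.
seed : ∀ {r} → (Fin r → ℕ) → Vec ℤ r → ℤ
seed q []      = 1ℤ
seed q (x ∷ v) = wave (q zero) x *ᶻ seed (q ∘ suc) v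

seed-0 : ∀ {r} (q : Fin r → ℕ) → (∀ p → 2 ≤ q p) → seed q (replicateᵛ r 0ℤ) ≡ 1ℤ
seed-0 {zero}  q 2≤q = refl
seed-0 {suc r} q 2≤q = cong₂ _*ᶻ_ (wave-0 (q zero) (2≤q zero)) (seed-0 (q ∘ suc) (2≤q ∘ suc))

-- Along the orbit only the factor at p varies, and the others can be taken out. The values z = 1
-- and z = -1 cover the two directions.
seed-vanishing : ∀ {r} (q : Fin r → ℕ) (z : ℤ) →
  (∀ k → Vanishing k (λ x → z +ᶻ (z +ᶻ x)) (wave k)) → ∀ p →
  Vanishing (q p) (λ v → updateAt (updateAt v p (z +ᶻ_)) p (z +ᶻ_)) (seed q)
seed-vanishing q z van zero (x ∷ v) =
  trans (head (q zero) x) (trans (cong (_*ᶻ seed (q ∘ suc) v) (van (q zero) x)) (ℤ.*-zeroˡ (seed (q ∘ suc) v)))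
  where
  head : ∀ k x → orbitSum k (λ v → updateAt (updateAt v zero (z +ᶻ_)) zero (z +ᶻ_)) (seed q) (x ∷ v)
               ≡ orbitSum k (λ x → z +ᶻ (z +ᶻ x)) (wave (q zero)) x *ᶻ seed (q ∘ suc) v
  head zero    x = refl
  head (suc k) x = trans (cong (seed q (x ∷ v) +ᶻ_) (head k _))
                         (sym (ℤ.*-distribʳ-+ (seed (q ∘ suc) v) (wave (q zero) x) _))
seed-vanishing q z van (suc p) (x ∷ v) =
  trans (tail (q (suc p)) v)
        (trans (cong (wave (q zero) x *ᶻ_) (seed-vanishing (q ∘ suc) z van p v)) (ℤ.*-zeroʳ (wave (q zero) x)))
  where
  tail : ∀ k v → orbitSum k (λ v → updateAt (updateAt v (suc p) (z +ᶻ_)) (suc p) (z +ᶻ_)) (seed q) (x ∷ v)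
               ≡ wave (q zero) x *ᶻ orbitSum k (λ v → updateAt (updateAt v p (z +ᶻ_)) p (z +ᶻ_)) (seed (q ∘ suc)) v
  tail zero    v = sym (ℤ.*-zeroʳ (wave (q zero) x))
  tail (suc k) v = trans (cong (seed q (x ∷ v) +ᶻ_) (tail k _)) (sym (ℤ.*-distribˡ-+ (wave (q zero) x) _ _))

seed-cyclotomic : ∀ r (q : Fin r → ℕ) → Lattice.Cyclotomic r q (seed q)
seed-cyclotomic r q = record
  { up-vanishing = seed-vanishing q 1ℤ wave-up²
  ; dn-vanishing = seed-vanishing q (- 1ℤ) wave-dn² }

-- Bounds and sums over the generators

bounded : ∀ {n} (f : Fin n → ℕ) → ∃[ B ] ∀ i → f i ≤ B
bounded {zero}  f = 0 , λ ()
bounded {suc n} f with bounded (f ∘ suc)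
... | B , f≤B = f zero + B , λ { zero    → ℕ.m≤m+n (f zero) B
                               ; (suc i) → ℕ.m≤n⇒m≤o+n (f zero) (f≤B i) }

total : ∀ {n} → (Fin n → ℤ) → ℤ
total {zero}  t = 0ℤ
total {suc n} t = t zero +ᶻ total (t ∘ suc)

total-cong : ∀ {n} {t t′ : Fin n → ℤ} → t ≗ t′ → total t ≡ total t′
total-cong {zero}  e = refl
total-cong {suc n} e = cong₂ _+ᶻ_ (e zero) (total-cong (e ∘ suc))

total-0 : ∀ n → total {n} (λ _ → 0ℤ) ≡ 0ℤ
total-0 zero    = refl
total-0 (suc n) = trans (ℤ.+-identityˡ _) (total-0 n)

-- Isolates one summand: with `t′` taken at an initial state, the bracket is a term that stays fixed
-- while the j-th one changes.
total-change : ∀ {n} {t t′ : Fin n → ℤ} j → (∀ k → k ≢ j → t k ≡ t′ k) →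
               total t ≡ t j +ᶻ (total t′ -ᶻ t′ j)
total-change {t = t} {t′} zero agree =
  trans (cong (t zero +ᶻ_) (total-cong λ k → agree (suc k) λ ())) (rearrange (t zero) (t′ zero) (total (t′ ∘ suc)))
  where
  rearrange : ∀ a b c → a +ᶻ c ≡ a +ᶻ ((b +ᶻ c) -ᶻ b)
  rearrange = solve-∀
total-change {t = t} {t′} (suc j) agree =
  trans (cong₂ _+ᶻ_ (agree zero λ ()) (total-change j λ k k≢j → agree (suc k) (k≢j ∘ Fin.suc-injective)))
        (rearrange (t′ zero) (t (suc j)) (total (t′ ∘ suc)) (t′ (suc j)))
  where
  rearrange : ∀ a b c d → a +ᶻ (b +ᶻ (c -ᶻ d)) ≡ b +ᶻ ((a +ᶻ c) -ᶻ d)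
  rearrange = solve-∀

-- The reflection representation over cyclotomic functions

module Reflections {n : ℕ} (M : CoxeterMatrix n) where
  open CoxeterMatrix M
  open Coxeter M

  order-bound : ∃[ B ] ∀ i j → m i j ≤ B
  order-bound with bounded (λ i → proj₁ (bounded (m i)))
  ... | B , ≤B = B , λ i j → ℕ.≤-trans (proj₂ (bounded (m i)) j) (≤B i)

  -- Coordinate p is reserved for the order p + 2, so r has to exceed every m_ij - 2. Pairs with the
  -- same order share a coordinate.
  r : ℕ
  r = suc (proj₁ order-bound)

  q : Fin r → ℕ
  q p = 2 + toℕ p

  open Lattice r q

  edge : Fin n → Fin n → Fin r
  edge i j = fromℕ< (s≤s (ℕ.≤-trans (ℕ.m∸n≤m (m i j) 2) (proj₂ order-bound i j)))

  edge-sym : ∀ i j → edge i j ≡ edge j i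
  edge-sym i j = Fin.fromℕ<-cong _ _ (cong (_∸ 2) (symm i j)) _ _

  q-edge : ∀ {i j} → i ≢ j → q (edge i j) ≡ m i j
  q-edge i≢j = trans (cong (λ k → 2 + k) (Fin.toℕ-fromℕ< _)) (ℕ.m+[n∸m]≡n (off _ _ i≢j))

  State : Set
  State = Fin n → A → ℤ

  _≋_ : State → State → Set
  x ≋ y = ∀ k v → x k v ≡ y k v

  coupling : Fin n → Fin n → (A → ℤ) → A → ℤ
  coupling i j f v with i Fin.≟ j
  ... | yes _ = 0ℤ
  ... | no  _ = f (up (edge i j) v) +ᶻ f (dn (edge i j) v)

  -- The Tits reflection in simple-root coordinates, with ζ + ζ⁻¹ in the place of 2cos(π/m_il).
  reflect : Fin n → State → State
  reflect i x k v with k Fin.≟ i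
  ... | yes _ = - x i v +ᶻ total (λ l → coupling i l (x l) v)
  ... | no  _ = x k v

  act : Word → State → State
  act []      x = x
  act (i ∷ u) x = reflect i (act u x)

  coupling-cong : ∀ i j {f g} → f ≗ g → coupling i j f ≗ coupling i j g
  coupling-cong i j e v with i Fin.≟ j
  ... | yes _ = refl
  ... | no  _ = cong₂ _+ᶻ_ (e _) (e _)

  coupling-self : ∀ i f v → coupling i i f v ≡ 0ℤ
  coupling-self i f v with i Fin.≟ i
  ... | yes _  = refl
  ... | no i≢i = contradiction refl i≢i

  coupling-edge : ∀ {i j} → i ≢ j → ∀ f v →
                  coupling i j f v ≡ f (up (edge i j) v) +ᶻ f (dn (edge i j) v)
  coupling-edge {i} {j} i≢j f v with i Fin.≟ j
  ... | yes i≡j = contradiction i≡j i≢j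
  ... | no  _   = refl

  reflect-at : ∀ i x v → reflect i x i v ≡ - x i v +ᶻ total (λ l → coupling i l (x l) v)
  reflect-at i x v with i Fin.≟ i
  ... | yes _  = refl
  ... | no i≢i = contradiction refl i≢i

  reflect-off : ∀ {i k} → k ≢ i → ∀ x v → reflect i x k v ≡ x k v
  reflect-off {i} {k} k≢i x v with k Fin.≟ i
  ... | yes k≡i = contradiction k≡i k≢i
  ... | no  _   = refl

  reflect-cong : ∀ i {x y} → x ≋ y → reflect i x ≋ reflect i y
  reflect-cong i e k v with k Fin.≟ i
  ... | yes _ = cong₂ (λ a b → - a +ᶻ b) (e i v) (total-cong λ l → coupling-cong i l (e l) v)
  ... | no  _ = e k v

  act-cong : ∀ u {x y} → x ≋ y → act u x ≋ act u y
  act-cong []      e = e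
  act-cong (i ∷ u) e = reflect-cong i (act-cong u e)

  act-++ : ∀ u w x → act (u ++ w) x ≡ act u (act w x)
  act-++ []      w x = refl
  act-++ (i ∷ u) w x = cong (reflect i) (act-++ u w x)

  reflect-involutive : ∀ i x → reflect i (reflect i x) ≋ x
  reflect-involutive i x k v with k Fin.≟ i
  ... | no k≢i   = reflect-off k≢i x v
  ... | yes refl = begin
    - reflect i x i v +ᶻ total (λ l → coupling i l (reflect i x l) v)
      ≡⟨ cong₂ (λ a b → - a +ᶻ b) (reflect-at i x v) (total-cong same) ⟩
    - (- x i v +ᶻ total (λ l → coupling i l (x l) v)) +ᶻ total (λ l → coupling i l (x l) v)
      ≡⟨ cancels (x i v) (total (λ l → coupling i l (x l) v)) ⟩
    x i v ∎
    where
    open ≡-Reasoning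
    cancels : ∀ a b → - (- a +ᶻ b) +ᶻ b ≡ a
    cancels = solve-∀
    same : ∀ l → coupling i l (reflect i x l) v ≡ coupling i l (x l) v
    same l with l Fin.≟ i
    ... | yes refl = trans (coupling-self i _ v) (sym (coupling-self i _ v))
    ... | no  l≢i  = coupling-cong i l (λ w → refl) v

  CyclotomicState : State → Set
  CyclotomicState x = ∀ k → Cyclotomic (x k)

  cyclotomic-coupling : ∀ i j {f} → Cyclotomic f → Cyclotomic (coupling i j f)
  cyclotomic-coupling i j cf with i Fin.≟ j
  ... | yes _ = cyclotomic-0
  ... | no  _ = cyclotomic-+ (cyclotomic-shift (edge i j) 1ℤ cf) (cyclotomic-shift (edge i j) (- 1ℤ) cf)

  cyclotomic-total : ∀ {k} (t : Fin k → A → ℤ) → (∀ l → Cyclotomic (t l)) →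
                     Cyclotomic (λ v → total (λ l → t l v))
  cyclotomic-total {zero}  t ct = cyclotomic-0
  cyclotomic-total {suc k} t ct = cyclotomic-+ (ct zero) (cyclotomic-total (t ∘ suc) (ct ∘ suc))

  cyclotomic-reflect : ∀ i {x} → CyclotomicState x → CyclotomicState (reflect i x)
  cyclotomic-reflect i cx k with k Fin.≟ i
  ... | yes _ = cyclotomic-+ (cyclotomic-neg (cx i)) (cyclotomic-total _ λ l → cyclotomic-coupling i l (cx l))
  ... | no  _ = cx k

  cyclotomic-act : ∀ u {x} → CyclotomicState x → CyclotomicState (act u x)
  cyclotomic-act []      cx = cx
  cyclotomic-act (i ∷ u) cx = cyclotomic-reflect i (cyclotomic-act u cx)

  module Braid {i j : Fin n} (i≢j : i ≢ j) (x : State) (cx : CyclotomicState x) where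

    p : Fin r
    p = edge i j

    orbit : ℕ → State
    orbit l = act (concat (replicate l (i ∷ j ∷ []))) x

    cyclotomic-orbit : ∀ l → CyclotomicState (orbit l)
    cyclotomic-orbit l = cyclotomic-act (concat (replicate l (i ∷ j ∷ []))) cx

    AgreesOff : State → Set
    AgreesOff y = ∀ k → k ≢ i → k ≢ j → y k ≗ x k

    agrees-reflect-i : ∀ {y} → AgreesOff y → AgreesOff (reflect i y)
    agrees-reflect-i {y} agree k k≢i k≢j v = trans (reflect-off k≢i y v) (agree k k≢i k≢j v)

    agrees-reflect-j : ∀ {y} → AgreesOff y → AgreesOff (reflect j y)
    agrees-reflect-j {y} agree k k≢i k≢j v = trans (reflect-off k≢j y v) (agree k k≢i k≢j v)

    agrees-orbit : ∀ l → AgreesOff (orbit l)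
    agrees-orbit zero    k k≢i k≢j v = refl
    agrees-orbit (suc l) = agrees-reflect-i (agrees-reflect-j (agrees-orbit l))

    -- What coordinate a receives from all generators other than a and b; it is constant while s_a
    -- and s_b act.
    external : Fin n → Fin n → A → ℤ
    external a b v = total (λ l → coupling a l (x l) v) -ᶻ coupling a b (x b) v

    cyclotomic-external : ∀ a b → Cyclotomic (external a b)
    cyclotomic-external a b = cyclotomic-+ (cyclotomic-total _ λ l → cyclotomic-coupling a l (cx l))
                                           (cyclotomic-neg (cyclotomic-coupling a b (cx b)))

    reflect-i : ∀ {y} → AgreesOff y → ∀ v →
      reflect i y i v ≡ - y i v +ᶻ ((y j (up p v) +ᶻ y j (dn p v)) +ᶻ external i j v)
    reflect-i {y} agree v = trans (reflect-at i y v) (cong (- y i v +ᶻ_)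
      (trans (total-change j agree′) (cong (_+ᶻ external i j v) (coupling-edge i≢j (y j) v))))
      where
      agree′ : ∀ k → k ≢ j → coupling i k (y k) v ≡ coupling i k (x k) v
      agree′ k k≢j with k Fin.≟ i
      ... | yes refl = trans (coupling-self i (y i) v) (sym (coupling-self i (x i) v))
      ... | no  k≢i  = coupling-cong i k (agree k k≢i k≢j) v

    reflect-j : ∀ {y} → AgreesOff y → ∀ v →
      reflect j y j v ≡ - y j v +ᶻ ((y i (up p v) +ᶻ y i (dn p v)) +ᶻ external j i v)
    reflect-j {y} agree v = trans (reflect-at j y v) (cong (- y j v +ᶻ_)
      (trans (total-change i agree′) (cong (_+ᶻ external j i v)
        (trans (coupling-edge (i≢j ∘ sym) (y i) v)
               (cong (λ e → y i (up e v) +ᶻ y i (dn e v)) (edge-sym j i))))))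
      where
      agree′ : ∀ k → k ≢ i → coupling j k (y k) v ≡ coupling j k (x k) v
      agree′ k k≢i with k Fin.≟ j
      ... | yes refl = trans (coupling-self j (y j) v) (sym (coupling-self j (x j) v))
      ... | no  k≢j  = coupling-cong j k (agree k k≢i k≢j) v

    a b : ℕ → A → ℤ
    a l = orbit l i
    b l = orbit l j

    b-step : ∀ l v → b (suc l) v ≡ - b l v +ᶻ ((a l (up p v) +ᶻ a l (dn p v)) +ᶻ external j i v)
    b-step l v = trans (reflect-off (i≢j ∘ sym) (reflect j (orbit l)) v) (reflect-j (agrees-orbit l) v)

    -- The letter j acts before i, so the updated b enters here.
    a-step : ∀ l v → a (suc l) v ≡ - a l v +ᶻ ((b (suc l) (up p v) +ᶻ b (suc l) (dn p v)) +ᶻ external i j v)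
    a-step l v = trans (reflect-i (agrees-reflect-j (agrees-orbit l)) v)
      (cong₂ (λ c d → - c +ᶻ (d +ᶻ external i j v))
        (reflect-off i≢j (orbit l) v)
        (cong₂ _+ᶻ_ (sym (reflect-off (i≢j ∘ sym) (reflect j (orbit l)) (up p v)))
                    (sym (reflect-off (i≢j ∘ sym) (reflect j (orbit l)) (dn p v)))))

    -- Over ℤ[ζ] the combinations a − ζ b and a − ζ⁻¹ b are, up to a constant term,
    -- eigenvectors of s_i s_j with eigenvalues ζ⁻² and ζ².
    module Eigen (σ τ : A → A) (στ : ∀ v → σ (τ v) ≡ v)
      (a-step′ : ∀ l v → a (suc l) v ≡ - a l v +ᶻ ((b (suc l) (σ v) +ᶻ b (suc l) (τ v)) +ᶻ external i j v))
      (b-step′ : ∀ l v → b (suc l) v ≡ - b l v +ᶻ ((a l (σ v) +ᶻ a l (τ v)) +ᶻ external j i v)) where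

      eigen : ℕ → A → ℤ
      eigen l v = a l v -ᶻ b l (σ v)

      constant : A → ℤ
      constant v = external i j v +ᶻ external j i (τ v)

      eigen-step : ∀ l v → eigen (suc l) v ≡ eigen l (τ (τ v)) +ᶻ constant v
      eigen-step l v = begin
        a (suc l) v -ᶻ b′
          ≡⟨ cong (_-ᶻ b′) (a-step′ l v) ⟩
        (- a l v +ᶻ ((b′ +ᶻ b (suc l) (τ v)) +ᶻ external i j v)) -ᶻ b′
          ≡⟨ cong (λ z → (- a l v +ᶻ ((b′ +ᶻ z) +ᶻ external i j v)) -ᶻ b′) b-step-τ ⟩
        (- a l v +ᶻ ((b′ +ᶻ (- b l (τ v) +ᶻ ((a l v +ᶻ a l (τ (τ v))) +ᶻ c′))) +ᶻ external i j v)) -ᶻ b′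
          ≡⟨ simplify (a l v) b′ (b l (τ v)) (a l (τ (τ v))) c′ (external i j v) ⟩
        (a l (τ (τ v)) -ᶻ b l (τ v)) +ᶻ constant v
          ≡⟨ cong (λ w → (a l (τ (τ v)) -ᶻ b l w) +ᶻ constant v) (στ (τ v)) ⟨
        eigen l (τ (τ v)) +ᶻ constant v ∎
        where
        open ≡-Reasoning
        b′ = b (suc l) (σ v)
        c′ = external j i (τ v)
        b-step-τ : b (suc l) (τ v) ≡ - b l (τ v) +ᶻ ((a l v +ᶻ a l (τ (τ v))) +ᶻ c′)
        b-step-τ = trans (b-step′ l (τ v))
                         (cong (λ w → - b l (τ v) +ᶻ ((a l w +ᶻ a l (τ (τ v))) +ᶻ c′)) (στ v))
        simplify : ∀ α β γ δ ε φ →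
          (- α +ᶻ ((β +ᶻ (- γ +ᶻ ((α +ᶻ δ) +ᶻ ε))) +ᶻ φ)) -ᶻ β ≡ (δ -ᶻ γ) +ᶻ (φ +ᶻ ε)
        simplify = solve-∀

    module Up = Eigen (up p) (dn p) (up-dn p) a-step b-step
    -- The step formulas are symmetric in ζ and ζ⁻¹; exchanging the two gives the second
    -- eigenvector.
    module Dn = Eigen (dn p) (up p) (dn-up p)
      (λ l v → trans (a-step l v) (cong (λ z → - a l v +ᶻ (z +ᶻ external i j v)) (ℤ.+-comm (b (suc l) (up p v)) _)))
      (λ l v → trans (b-step l v) (cong (λ z → - b l v +ᶻ (z +ᶻ external j i v)) (ℤ.+-comm (a l (up p v)) _)))

    -- The initial eigenvector and the constant term are both cyclotomic, so q steps of the affine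
    -- recursion return to the start.
    up-periodic : Up.eigen (q p) ≗ Up.eigen 0
    up-periodic = affine-periodic (q p) (dn p ∘ dn p) Up.constant Up.eigen Up.eigen-step
      (dn-vanishing (cyclotomic-+ (cyclotomic-external i j) (cyclotomic-shift p (- 1ℤ) (cyclotomic-external j i))) p)
      (dn-vanishing (cyclotomic-+ (cx i) (cyclotomic-neg (cyclotomic-shift p 1ℤ (cx j)))) p)

    dn-periodic : Dn.eigen (q p) ≗ Dn.eigen 0
    dn-periodic = affine-periodic (q p) (up p ∘ up p) Dn.constant Dn.eigen Dn.eigen-step
      (up-vanishing (cyclotomic-+ (cyclotomic-external i j) (cyclotomic-shift p 1ℤ (cyclotomic-external j i))) p)
      (up-vanishing (cyclotomic-+ (cx i) (cyclotomic-neg (cyclotomic-shift p (- 1ℤ) (cx j)))) p)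

    defect : A → ℤ
    defect v = b (q p) v -ᶻ b 0 v

    difference : ∀ α β γ δ → α -ᶻ β ≡ γ -ᶻ δ → β -ᶻ δ ≡ α -ᶻ γ
    difference α β γ δ e = begin
      β -ᶻ δ                         ≡⟨ expand α β γ δ ⟩
      (α -ᶻ γ) -ᶻ ((α -ᶻ β) -ᶻ (γ -ᶻ δ))  ≡⟨ cong (λ z → (α -ᶻ γ) -ᶻ (z -ᶻ (γ -ᶻ δ))) e ⟩
      (α -ᶻ γ) -ᶻ ((γ -ᶻ δ) -ᶻ (γ -ᶻ δ))  ≡⟨ collapse α γ δ ⟩
      α -ᶻ γ                         ∎
      where
      open ≡-Reasoning
      expand : ∀ α β γ δ → β -ᶻ δ ≡ (α -ᶻ γ) -ᶻ ((α -ᶻ β) -ᶻ (γ -ᶻ δ))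
      expand = solve-∀
      collapse : ∀ α γ δ → (α -ᶻ γ) -ᶻ ((γ -ᶻ δ) -ᶻ (γ -ᶻ δ)) ≡ α -ᶻ γ
      collapse = solve-∀

    defect-up : ∀ v → defect (up p v) ≡ a (q p) v -ᶻ a 0 v
    defect-up v = difference (a (q p) v) (b (q p) (up p v)) (a 0 v) (b 0 (up p v)) (up-periodic v)

    defect-dn : ∀ v → defect (dn p v) ≡ a (q p) v -ᶻ a 0 v
    defect-dn v = difference (a (q p) v) (b (q p) (dn p v)) (a 0 v) (b 0 (dn p v)) (dn-periodic v)

    -- Both eigenvectors return, so the defect has equal shifts up and down and is invariant under
    -- ζ². Being cyclotomic, it vanishes; this replaces division by ζ - ζ⁻¹.
    defect-0 : ∀ v → defect v ≡ 0ℤ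
    defect-0 = vanishing-invariant⇒0 (q p) (up p ∘ up p) defect
      (up-vanishing (cyclotomic-+ (cyclotomic-orbit (q p) j) (cyclotomic-neg (cx j))) p)
      (λ v → trans (defect-up (up p v)) (trans (sym (defect-dn (up p v))) (cong defect (dn-up p v))))

    orbit-closed : orbit (q p) ≋ x
    orbit-closed k v = by-cases (k Fin.≟ i) (k Fin.≟ j)
      where
      by-cases : Dec (k ≡ i) → Dec (k ≡ j) → orbit (q p) k v ≡ x k v
      by-cases (yes refl) _          = ℤ.i-j≡0⇒i≡j _ _ (trans (sym (defect-up v)) (defect-0 (up p v)))
      by-cases (no _)     (yes refl) = ℤ.i-j≡0⇒i≡j _ _ (defect-0 v)
      by-cases (no k≢i)   (no k≢j)   = agrees-orbit (q p) k k≢i k≢j v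

  act-relator : ∀ i j x → CyclotomicState x → act (relator i j) x ≋ x
  act-relator i j x cx with i Fin.≟ j
  ... | yes refl = subst (λ k → act (concat (replicate k (i ∷ i ∷ []))) x ≋ x)
                         (sym (diag i)) (reflect-involutive i x)
  ... | no i≢j   = subst (λ k → act (concat (replicate k (i ∷ j ∷ []))) x ≋ x)
                         (q-edge i≢j) (Braid.orbit-closed i≢j x cx)

  act-≈ : ∀ {u w} → u ≈ w → ∀ {x} → CyclotomicState x → act u x ≋ act w x
  act-≈ ≈-refl        cx k v = refl
  act-≈ (≈-sym e)     cx k v = sym (act-≈ e cx k v)
  act-≈ (≈-trans e f) cx k v = trans (act-≈ e cx k v) (act-≈ f cx k v)
  act-≈ (≈-rel i j)   cx k v = act-relator i j _ cx k v
  act-≈ (≈-cong {c} {d} {e} {f} g h) {x} cx k v = begin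
    act (c ++ e) x k v     ≡⟨ cong (λ y → y k v) (act-++ c e x) ⟩
    act c (act e x) k v    ≡⟨ act-cong c (act-≈ h cx) k v ⟩
    act c (act f x) k v    ≡⟨ act-≈ g (cyclotomic-act f cx) k v ⟩
    act d (act f x) k v    ≡⟨ cong (λ y → y k v) (act-++ d f x) ⟨
    act (d ++ f) x k v     ∎
    where open ≡-Reasoning

  act-fixes : ∀ {K s w} → s ∉ K → All (_∈ K) w → ∀ x v → act w x s v ≡ x s v
  act-fixes s∉K []         x v = refl
  act-fixes {w = _ ∷ w} s∉K (i∈K ∷ wK) x v =
    trans (reflect-off (λ { refl → s∉K i∈K }) (act w x) v) (act-fixes s∉K wK x v)

  -- Put `seed` in coordinate s and 0 elsewhere. The generator s negates this coordinate, words over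
  -- K leave it alone, and its value at the origin is 1.
  generator∉parabolic : ∀ {K s} → s ∉ K → ¬ Parabolic.SameCoset K [ s ] []
  generator∉parabolic {K} {s} s∉K (w , wK , s≈w) = contradiction -1≡1 λ ()
    where
    open ≡-Reasoning
    x : State
    x k v with k Fin.≟ s
    ... | yes _ = seed q v
    ... | no  _ = 0ℤ
    cyclotomic-x : CyclotomicState x
    cyclotomic-x k with k Fin.≟ s
    ... | yes _ = seed-cyclotomic r q
    ... | no  _ = cyclotomic-0
    origin : A
    origin = replicateᵛ r 0ℤ
    x-s : x s origin ≡ 1ℤ
    x-s with s Fin.≟ s
    ... | yes _  = seed-0 q (λ _ → s≤s (s≤s z≤n))
    ... | no s≢s = contradiction refl s≢s
    uncoupled : ∀ l → coupling s l (x l) origin ≡ 0ℤ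
    uncoupled l with s Fin.≟ l | l Fin.≟ s
    ... | yes _  | _       = refl
    ... | no s≢l | yes l≡s = contradiction (sym l≡s) s≢l
    ... | no _   | no _    = refl
    -1≡1 : - 1ℤ ≡ 1ℤ
    -1≡1 = begin
      - 1ℤ                                                        ≡⟨ cong -_ x-s ⟨
      - x s origin                                                ≡⟨ ℤ.+-identityʳ _ ⟨
      - x s origin +ᶻ 0ℤ
        ≡⟨ cong (- x s origin +ᶻ_) (trans (total-cong uncoupled) (total-0 n)) ⟨
      - x s origin +ᶻ total (λ l → coupling s l (x l) origin)     ≡⟨ reflect-at s x origin ⟨
      reflect s x s origin                                        ≡⟨ act-≈ s≈w cyclotomic-x s origin ⟩
      act w x s origin                                            ≡⟨ act-fixes s∉K wK x origin ⟩
      x s origin                                                  ≡⟨ x-s ⟩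
      1ℤ                                                          ∎

-- The cardinality of `I` and the equivalence

module _ {n : ℕ} {I : Subset n} {s : Fin n} (s∉I : s ∉ I) where

  -- A second missing i would give strict inclusions of I in I ∪ {s} and of I ∪ {s} in S, hence |I|
  -- ≤ n - 2.
  card⇒others∈I : ∣ I ∣ + 1 ≡ n → ∀ i → i ≢ s → i ∈ I
  card⇒others∈I card i i≢s = decidable-stable (i ∈? I) λ i∉I →
    ℕ.<-irrefl card (subst (_< n) (ℕ.+-comm 1 ∣ I ∣) (subst (suc (suc ∣ I ∣) ≤_) (∣⊤∣≡n n)
      (ℕ.≤-trans (s≤s (p⊂q⇒∣p∣<∣q∣ I⊂I∪s)) (p⊂q⇒∣p∣<∣q∣ (I∪s⊂⊤ i∉I)))))
    where
    I⊂I∪s : I ⊂ I ∪ ⁅ s ⁆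
    I⊂I∪s = p⊆p∪q ⁅ s ⁆ , s , q⊆p∪q I ⁅ s ⁆ (x∈⁅x⁆ s) , s∉I
    I∪s⊂⊤ : i ∉ I → I ∪ ⁅ s ⁆ ⊂ ⊤
    I∪s⊂⊤ i∉I = (λ _ → ∈⊤) , i , ∈⊤ , i∉I∪s
      where
      i∉I∪s : i ∉ I ∪ ⁅ s ⁆
      i∉I∪s i∈ with x∈p∪q⁻ I ⁅ s ⁆ i∈
      ... | inj₁ i∈I = i∉I i∈I
      ... | inj₂ i∈s = i≢s (x∈⁅y⁆⇒x≡y s i∈s)

  others∈I⇒card : (∀ i → i ≢ s → i ∈ I) → ∣ I ∣ + 1 ≡ n
  others∈I⇒card others = ℕ.≤-antisym
    (subst (_≤ n) (ℕ.+-comm 1 ∣ I ∣)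
      (subst (∣ I ∣ <_) (∣⊤∣≡n n) (p⊂q⇒∣p∣<∣q∣ ((λ _ → ∈⊤) , s , ∈⊤ , s∉I))))
    (ℕ.≤-trans (ℕ.m≤n+m∸n n ∣ I ∣) (ℕ.+-monoʳ-≤ ∣ I ∣ (subst (_≤ 1) (∣∁p∣≡n∸∣p∣ I)
      (subst (∣ ∁ I ∣ ≤_) (∣⁅x⁆∣≡1 s) (p⊆q⇒∣p∣≤∣q∣ ∁I⊆s)))))
    where
    ∁I⊆s : ∁ I ⊆ ⁅ s ⁆
    ∁I⊆s {i} i∈∁I with i Fin.≟ s
    ... | yes refl = x∈⁅x⁆ s
    ... | no  i≢s  = contradiction (others i i≢s) (x∈∁p⇒x∉p i∈∁I)

  -- For a second missing i and K = I ∪ {s}, the pair {W_I, sW_I} lies in W_K/W_I and stays there,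
  -- whereas iW_I lies outside.
  percolates⇒others∈I : (M : CoxeterMatrix n) → Coxeter.IsFinite M →
    Coxeter.Parabolic.StronglyPercolates M I → ∀ i → i ≢ s → i ∈ I
  percolates⇒others∈I M fin percolates i i≢s = decidable-stable (i ∈? I) λ i∉I →
    generator∉parabolic (i∉K i∉I) (confined [] pair⊆W_K (percolates [ s ] (generator∉parabolic s∉I)) [ i ])
    where
    K : Subset n
    K = I ∪ ⁅ s ⁆
    open Coxeter M
    open Reflections M using (generator∉parabolic)
    open Confinement M fin I K (p⊆p∪q ⁅ s ⁆)
    i∉K : i ∉ I → i ∉ K
    i∉K i∉I i∈K with x∈p∪q⁻ I ⁅ s ⁆ i∈K
    ... | inj₁ i∈I = i∉I i∈I
    ... | inj₂ i∈s = i≢s (x∈⁅y⁆⇒x≡y s i∈s)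
    pair⊆W_K : ∀ w → I.pair [ s ] w → K.SameCoset w []
    pair⊆W_K w (inj₁ w~[]) = I⇒K w~[]
    pair⊆W_K w (inj₂ w~s)  = K.~-trans (I⇒K w~s) (K.~-absorb (q⊆p∪q I ⁅ s ⁆ (x∈⁅x⁆ s)))

theorem3p11 : (n : ℕ) (M : CoxeterMatrix n) → Coxeter.IsFinite M →
    (I : Subset n) → I ⊂ ⊤ →
    (Coxeter.Parabolic.StronglyPercolates M I ⇔ (∣ I ∣ + 1 ≡ n))
theorem3p11 n M fin I (_ , s , _ , s∉I) = mk⇔
  (λ percolates → others∈I⇒card s∉I (percolates⇒others∈I s∉I M fin percolates))
  (λ card → Maximal.strongly-percolates M fin I s (card⇒others∈I s∉I card))
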